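{- For every computable copy $\mathcal{L}$ of $\omega$, there is a $\Pi_2$ cohesive set $C$ such that $\prod_C \mathcal{L} \not\cong \omega + \eta$.
   Context: $\Pi_2$ refers to the arithmetical hierarchy of subsets of $\mathbb{N}$; c.e. means computably enumerable. For $X, Y \subseteq \mathbb{N}$, $X \subseteq^* Y$ means that $X \setminus Y$ is finite. A set $C \subseteq \mathbb{N}$ is cohesive if it is infinite and for every c.e. set $W$, either $C \subseteq^* W$ or $C \subseteq^* \mathbb{N} \setminus W$. A computable linear order $\mathcal{L} = (L; \prec_{\mathcal{L}})$ consists of a non-empty computable set $L \subseteq \mathbb{N}$ and a computable (strict) linear order relation $\prec_{\mathcal{L}}$ on $L$. A computable copy of $\omega$ is a computable linear order that is isomorphic to $(\mathbb{N}; <)$ (by a not necessarily computable isomorphism). $\omega$ and $\eta$ denote the order-types of $(\mathbb{N};<)$ and $(\mathbb{Q};<)$, and $+$ is the usual sum of linear orders. Cohesive power: for a computable linear order $\mathcal{L} = (L; \prec_{\mathcal{L}})$ and a cohesive set $C$, let $D$ be the set of partial computable functions $\varphi \colon \mathbb{N} \rightharpoonup L$ with $C \subseteq^* \mathrm{dom}(\varphi)$. For $\varphi, \psi \in D$, let $\varphi =_C \psi$ if $C \subseteq^* \{n : \varphi(n)\downarrow = \psi(n)\downarrow\}$; this is an equivalence relation, and $[\varphi]$ denotes the class of $\varphi$. The cohesive power $\prod_C \mathcal{L}$ is the linear order with domain $\{[\varphi] : \varphi \in D\}$ where $[\psi] \prec [\varphi]$ if and only if $C \subseteq^* \{n : \psi(n)\downarrow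 \prec_{\mathcal{L}} \varphi(n)\downarrow\}$. -}

module Defs where

open import Data.Fin.Base using (Fin)
open import Data.List.Base using (List)
import Data.List.Membership.Propositional as List
open import Data.Nat.Base using (ℕ; zero; suc; _<_)
import Data.Nat.Properties as ℕ
open import Data.Nat.Properties using (<-cmp)
open import Data.Product.Base using (Σ; ∃; ∃₂; _×_; _,_; proj₁)
import Data.Rational.Properties as ℚ
open import Data.Sum.Base using (_⊎_)
open import Data.Sum.Relation.Binary.LeftOrder using (⊎-<-strictTotalOrder)
open import Data.Vec.Base using (Vec; []; _∷_; lookup)
open import Data.Vec.Relation.Binary.Pointwise.Inductive using (Pointwise; []; _∷_)
open import Function.Base using (_on_)
open import Function.Bundles using (_⇔_)
open import Level using (0ℓ) renaming (suc to lsuc)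
open import Relation.Binary.Bundles using (StrictTotalOrder)
open import Relation.Binary.Bundles.Raw using (RawRelation)
open import Relation.Binary.Core using (Rel)
open import Relation.Binary.Definitions using (tri<; tri≈; tri>)
open import Relation.Binary.Morphism.Structures using (IsOrderIsomorphism)
open import Relation.Binary.PropositionalEquality.Core using (_≡_; refl)
open import Relation.Binary.Structures using (IsStrictTotalOrder)
open import Relation.Nullary.Negation.Core using (¬_; contradiction)
open import Relation.Unary using (Pred; Satisfiable; _∈_; _⊆_; _∖_; ∁)

-- Programs for the k-ary partial recursive functions; the function denoted
-- by a program is given by the relation _[_]⇓_ below.
data Code : ℕ → Set where
  zeroᶜ : ∀ {k} → Code k
  sucᶜ  : Code 1
  projᶜ : ∀ {k} → Fin k → Code k
  compᶜ : ∀ {k m} → Code m → Vec (Code k) m → Code k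
  precᶜ : ∀ {k} → Code k → Code (suc (suc k)) → Code (suc k)
  muᶜ   : ∀ {k} → Code (suc k) → Code k

infix 4 _[_]⇓_

-- e [ xs ]⇓ y : the program e halts on the input xs with output y.
-- Primitive recursion is on the first argument, the step receiving the
-- predecessor and the previous value in front of the parameters;
-- minimisation requires convergence at all arguments below the least zero.
data _[_]⇓_ : ∀ {k} → Code k → Vec ℕ k → ℕ → Set where
  zero⇓  : ∀ {k} {xs : Vec ℕ k} → zeroᶜ [ xs ]⇓ 0
  suc⇓   : ∀ {x} → sucᶜ [ x ∷ [] ]⇓ suc x
  proj⇓  : ∀ {k} {xs : Vec ℕ k} (i : Fin k) → projᶜ i [ xs ]⇓ lookup xs i
  comp⇓  : ∀ {k m} {f : Code m} {gs : Vec (Code k) m} {xs ys z} →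
           Pointwise (λ g y → g [ xs ]⇓ y) gs ys →
           f [ ys ]⇓ z → compᶜ f gs [ xs ]⇓ z
  precZ⇓ : ∀ {k} {f : Code k} {g : Code (suc (suc k))} {xs z} →
           f [ xs ]⇓ z → precᶜ f g [ zero ∷ xs ]⇓ z
  precS⇓ : ∀ {k} {f : Code k} {g : Code (suc (suc k))} {n xs y z} →
           precᶜ f g [ n ∷ xs ]⇓ y → g [ n ∷ y ∷ xs ]⇓ z →
           precᶜ f g [ suc n ∷ xs ]⇓ z
  mu⇓    : ∀ {k} {f : Code (suc k)} {xs y} →
           (∀ i → i < y → ∃ λ z → f [ i ∷ xs ]⇓ suc z) →
           f [ y ∷ xs ]⇓ 0 → muᶜ f [ xs ]⇓ y

⇓-functional : ∀ {k} {e : Code k} {xs y z} → e [ xs ]⇓ y → e [ xs ]⇓ z → y ≡ z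
⇓-functional* : ∀ {k m} {gs : Vec (Code k) m} {xs ys zs} →
                Pointwise (λ g y → g [ xs ]⇓ y) gs ys →
                Pointwise (λ g y → g [ xs ]⇓ y) gs zs → ys ≡ zs

⇓-functional zero⇓ zero⇓ = refl
⇓-functional suc⇓ suc⇓ = refl
⇓-functional (proj⇓ i) (proj⇓ .i) = refl
⇓-functional (comp⇓ ps p) (comp⇓ qs q) with refl ← ⇓-functional* ps qs = ⇓-functional p q
⇓-functional (precZ⇓ p) (precZ⇓ q) = ⇓-functional p q
⇓-functional (precS⇓ p p′) (precS⇓ q q′) with refl ← ⇓-functional p q = ⇓-functional p′ q′
⇓-functional (mu⇓ {y = y} below p) (mu⇓ {y = z} below′ q) with <-cmp y z
... | tri≈ _ y≡z _ = y≡z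
... | tri< y<z _ _ with _ , r ← below′ y y<z = contradiction (⇓-functional p r) λ ()
... | tri> _ _ z<y with _ , r ← below z z<y = contradiction (⇓-functional r q) λ ()

⇓-functional* [] [] = refl
⇓-functional* (p ∷ ps) (q ∷ qs) with refl ← ⇓-functional p q | refl ← ⇓-functional* ps qs = refl

Dom : Code 1 → Pred ℕ 0ℓ
Dom e n = ∃ λ y → e [ n ∷ [] ]⇓ y

Decides : ∀ {k} → Code k → Vec ℕ k → Set → Set
Decides e xs P = (P × e [ xs ]⇓ 1) ⊎ (¬ P × e [ xs ]⇓ 0)

ComputableSet : Pred ℕ 0ℓ → Set
ComputableSet X = Σ (Code 1) λ e → ∀ n → Decides e (n ∷ []) (X n)

ComputableRel₂ : (ℕ → ℕ → Set) → Set
ComputableRel₂ R = Σ (Code 2) λ e → ∀ a b → Decides e (a ∷ b ∷ []) (R a b)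

ComputableRel₃ : (ℕ → ℕ → ℕ → Set) → Set
ComputableRel₃ R = Σ (Code 3) λ e → ∀ a b c → Decides e (a ∷ b ∷ c ∷ []) (R a b c)

IsCE : Pred ℕ 0ℓ → Set
IsCE W = Σ (Code 1) λ e → ∀ n → n ∈ W ⇔ n ∈ Dom e

IsΠ₂ : Pred ℕ 0ℓ → Set₁
IsΠ₂ X = Σ (ℕ → ℕ → ℕ → Set) λ R →
  ComputableRel₃ R × (∀ n → n ∈ X ⇔ (∀ a → ∃ λ b → R n a b))

Finite : Pred ℕ 0ℓ → Set
Finite X = Σ (List ℕ) λ xs → X ⊆ (List._∈ xs)

Infinite : Pred ℕ 0ℓ → Set
Infinite X = ¬ Finite X

infix 4 _⊆*_

_⊆*_ : Pred ℕ 0ℓ → Pred ℕ 0ℓ → Set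
X ⊆* Y = Finite (X ∖ Y)

IsCohesive : Pred ℕ 0ℓ → Set₁
IsCohesive C = Infinite C × (∀ W → IsCE W → (C ⊆* W) ⊎ (C ⊆* ∁ W))

-- A set (with an explicit equality, in place of quotients) and a relation.
Structure : Set₁
Structure = RawRelation 0ℓ 0ℓ 0ℓ

infix 4 _≅_

_≅_ : Structure → Structure → Set
A ≅ B = Σ (A.Carrier → B.Carrier) (IsOrderIsomorphism A._≈_ B._≈_ A._∼_ B._∼_)
  where
  module A = RawRelation A
  module B = RawRelation B

ω : StrictTotalOrder 0ℓ 0ℓ 0ℓ
ω = ℕ.<-strictTotalOrder

η : StrictTotalOrder 0ℓ 0ℓ 0ℓ
η = ℚ.<-strictTotalOrder

⟦_⟧ : StrictTotalOrder 0ℓ 0ℓ 0ℓ → Structure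
⟦ L ⟧ = StrictTotalOrder.rawRelation L

infixr 5 _⊕_

_⊕_ : StrictTotalOrder 0ℓ 0ℓ 0ℓ → StrictTotalOrder 0ℓ 0ℓ 0ℓ → StrictTotalOrder 0ℓ 0ℓ 0ℓ
_⊕_ = ⊎-<-strictTotalOrder {d = 0ℓ} {e = 0ℓ} {f = 0ℓ}

record ComputableLinearOrder : Set (lsuc 0ℓ) where
  infix 4 _≺_
  field
    L            : Pred ℕ 0ℓ
    _≺_          : Rel ℕ 0ℓ
    ≺-on-L       : ∀ {a b} → a ≺ b → a ∈ L × b ∈ L
    L-nonempty   : Satisfiable L
    L-computable : ComputableSet L
    ≺-computable : ComputableRel₂ _≺_
    -- Elements of L are numbers; membership proofs are disregarded.
    isStrictTotalOrder : IsStrictTotalOrder {A = Σ ℕ L} (_≡_ on proj₁) (_≺_ on proj₁)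

  strictTotalOrder : StrictTotalOrder 0ℓ 0ℓ 0ℓ
  strictTotalOrder = record { isStrictTotalOrder = isStrictTotalOrder }

IsCopyOfω : ComputableLinearOrder → Set
IsCopyOfω 𝓛 = ⟦ ComputableLinearOrder.strictTotalOrder 𝓛 ⟧ ≅ ⟦ ω ⟧

module CohesivePower (C : Pred ℕ 0ℓ) (𝓛 : ComputableLinearOrder) where
  open ComputableLinearOrder 𝓛

  -- Partial computable functions are represented by their programs; two
  -- programs for the same function are identified by =C.
  record D : Set where
    field
      code    : Code 1
      range⊆L : ∀ {n y} → code [ n ∷ [] ]⇓ y → y ∈ L
      C⊆*dom  : C ⊆* Dom code

  open D public

  infix 4 _=C_ _≺C_

  _=C_ : Rel D 0ℓ
  φ =C ψ = C ⊆* λ n → ∃ λ y → (code φ [ n ∷ [] ]⇓ y) × (code ψ [ n ∷ [] ]⇓ y)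

  _≺C_ : Rel D 0ℓ
  ψ ≺C φ = C ⊆* λ n → ∃₂ λ a b →
    (code ψ [ n ∷ [] ]⇓ a) × (code φ [ n ∷ [] ]⇓ b) × a ≺ b

∏ : Pred ℕ 0ℓ → ComputableLinearOrder → Structure
∏ C 𝓛 = record { Carrier = D ; _≈_ = _=C_ ; _∼_ = _≺C_ }
  where open CohesivePower C 𝓛

{-# OPTIONS --safe #-}
module Submission where

-- Let σₖ(x) be the number with binary digits β₀(x) … βₖ₋₁(x), where β₀ is the
-- indicator of the set A of codes of pairs of neighbours in 𝓛, a Π₁ set, and
-- βₑ₊₁ that of the e-th c.e. set.  Let C be the set of x for which there are no
-- k ≤ z < x < y with σₖ(x) ≤ σₖ(z) and σₖ(x) < σₖ(y).  The first maximum of σₙ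
-- on [n, ∞) lies in C, so C is infinite.  If m is the largest value that σₖ
-- takes infinitely often, then σₖ = m on almost all of C, so C is cohesive and
-- almost contained in A.  The bits are limits of computable approximations,
-- whence C is Π₂.  In the cohesive power the two components of the pairs in A
-- are neighbours, and they lie above all constants; ω + η has no such elements.

open import Axiom.ExcludedMiddle using (ExcludedMiddle)
open import Data.Empty using (⊥)
open import Data.Fin.Base using (Fin; zero; suc; toℕ; fromℕ<)
open import Data.Fin.Patterns
open import Data.Fin.Properties using (pigeonhole; fromℕ<-injective)
open import Data.List.Base as List using (List; upTo)
open import Data.List.Membership.Propositional using () renaming (_∈_ to _∈ₗ_)
open import Data.List.Membership.Propositional.Properties using (∈-upTo⁺)
open import Data.List.Relation.Unary.All as All using (All; []; _∷_)
open import Data.List.Relation.Unary.All.Properties using (++⁺; ++⁻ˡ; ++⁻ʳ; drop⁺)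
open import Data.List.Relation.Unary.Any using (here; there)
open import Data.Nat.Base as ℕ hiding (pred)
open import Data.Nat.Induction using (<-rec)
open import Data.Nat.Properties
open import Data.Product.Base using (Σ; ∃; ∃₂; _×_; _,_; proj₁; proj₂)
open import Data.Rational.Base as ℚ using (ℚ)
import Data.Rational.Properties as ℚ
open import Data.Sum.Base using (_⊎_; inj₁; inj₂; [_,_]′)
open import Data.Sum.Properties using (inj₁-injective)
open import Data.Sum.Relation.Binary.LeftOrder using (_⊎-<_; ₁∼₁; ₂∼₂)
open import Data.Sum.Relation.Binary.Pointwise as ⊎ using (inj₁; inj₂)
open import Data.Unit.Base using (⊤; tt)
open import Data.Vec.Base using (Vec; []; _∷_; lookup; map; tabulate)
open import Data.Vec.Relation.Binary.Pointwise.Inductive using (Pointwise; []; _∷_)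
open import Function.Base using (_∘_; _$_)
open import Function.Bundles using (_⇔_; mk⇔; Equivalence)
open import Level using (0ℓ)
open import Relation.Binary.Definitions using (tri<; tri≈; tri>)
open import Relation.Binary.Morphism.Structures using (IsOrderIsomorphism)
open import Relation.Binary.PropositionalEquality
open import Relation.Nullary.Decidable using (Dec; yes; no; decidable-stable)
open import Relation.Nullary.Negation.Core using (¬_; contradiction)
open import Relation.Unary using (Pred; _∈_)
open import Defs

-- Membership in C is a universal statement about finitely many bits at a time, and each bit is the
-- limit of computable stages. This keeps C at `Π₂`; selecting the elements of a cohesive set one
-- after the other would make membership depend on the whole run of earlier choices. The
-- approximation has to be computable uniformly in the index of the c.e. set. As programs are syntax
-- trees with a relational semantics, this takes a decidable halting predicate on numbers: a
-- computation is certified by a finite table of facts, each justified by others in the table.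
-- Adjacency of a pair excludes a third element anywhere in 𝓛, so A is given only by a universal
-- condition; as the leading digit, its bit takes precedence over all the c.e. sets. Neighbours
-- persist in the power because an element strictly between them would be so at some single number
-- in C.

private variable
  a b c d k m n : ℕ

-- Computable functions and decidable predicates

opaque
  least : {P : ℕ → Set} → (∀ n → Dec (P n)) → ∀ n → P n →
          ∃ λ i → P i × (∀ j → j < i → ¬ P j)
  least {P} P? = <-rec _ λ n rec Pn → case n rec Pn (anyUpTo? P? n)
    where
    case : ∀ n → (∀ {i} → i < n → P i → ∃ λ i → P i × (∀ j → j < i → ¬ P j)) → P n →
           Dec (∃ λ i → i < n × P i) → ∃ λ i → P i × (∀ j → j < i → ¬ P j)
    case n rec Pn (yes (i , i<n , Pi)) = rec i<n Pi
    case n rec Pn (no none) = n , Pn , λ j j<n Pj → none (j , j<n , Pj)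

infix 4 _[_]⇓*_

_[_]⇓*_ : Vec (Code k) m → Vec ℕ k → Vec ℕ m → Set
gs [ xs ]⇓* ys = Pointwise (λ g y → g [ xs ]⇓ y) gs ys

projections⇓ : (ρ : Fin m → Fin k) (xs : Vec ℕ k) (ys : Vec ℕ m) →
               (∀ i → lookup xs (ρ i) ≡ lookup ys i) →
               tabulate (projᶜ ∘ ρ) [ xs ]⇓* ys
projections⇓ ρ xs [] eq = []
projections⇓ ρ xs (y ∷ ys) eq =
  subst (projᶜ (ρ zero) [ xs ]⇓_) (eq zero) (proj⇓ (ρ zero)) ∷
  projections⇓ (ρ ∘ suc) xs ys (eq ∘ suc)

allVars : Vec (Code k) k
allVars = tabulate projᶜ

allVars⇓ : (xs : Vec ℕ k) → allVars [ xs ]⇓* xs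
allVars⇓ xs = projections⇓ (λ i → i) xs xs λ _ → refl

-- In the step of a recursion the second argument is the previous value.
dropSecond : Vec (Code (2 + k)) (1 + k)
dropSecond = projᶜ 0F ∷ tabulate (λ i → projᶜ (suc (suc i)))

dropSecond⇓ : ∀ n r (xs : Vec ℕ k) → dropSecond [ n ∷ r ∷ xs ]⇓* n ∷ xs
dropSecond⇓ n r xs = proj⇓ 0F ∷ projections⇓ (λ i → suc (suc i)) (n ∷ r ∷ xs) xs λ _ → refl

record Fn (k : ℕ) : Set where
  field
    apply    : Vec ℕ k → ℕ
    code     : Code k
    computes : ∀ xs → code [ xs ]⇓ apply xs

record DecPred (k : ℕ) : Set₁ where
  field
    pred    : Vec ℕ k → Set
    code    : Code k
    decides : ∀ xs → Decides code xs (pred xs)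

open Fn using (apply; computes)
open DecPred using (pred; decides)

value : ∀ {e : Code k} {xs P} → Decides e xs P → ∃ λ y → e [ xs ]⇓ y
value (inj₁ (_ , d)) = 1 , d
value (inj₂ (_ , d)) = 0 , d

if-yes : ∀ {e : Code k} {xs P} → Decides e xs P → P → e [ xs ]⇓ 1
if-yes (inj₁ (_ , d))  p = d
if-yes (inj₂ (¬p , _)) p = contradiction p ¬p

if-no : ∀ {e : Code k} {xs P} → Decides e xs P → ¬ P → e [ xs ]⇓ 0
if-no (inj₁ (p , _)) ¬p = contradiction p ¬p
if-no (inj₂ (_ , d)) ¬p = d

pred? : (P : DecPred k) → ∀ xs → Dec (pred P xs)
pred? P xs with decides P xs
... | inj₁ (p , _)  = yes p
... | inj₂ (¬p , _) = no ¬p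

applies : Vec (Fn k) m → Vec ℕ k → Vec ℕ m
applies []       xs = []
applies (f ∷ fs) xs = apply f xs ∷ applies fs xs

computes* : (fs : Vec (Fn k) m) → ∀ xs → map Fn.code fs [ xs ]⇓* applies fs xs
computes* []       xs = []
computes* (f ∷ fs) xs = computes f xs ∷ computes* fs xs

infixl 9 _⟨_⟩ᶠ _⟨_⟩ᵈ

_⟨_⟩ᶠ : Fn m → Vec (Fn k) m → Fn k
f ⟨ gs ⟩ᶠ = record
  { apply    = λ xs → apply f (applies gs xs)
  ; code     = compᶜ (Fn.code f) (map Fn.code gs)
  ; computes = λ xs → comp⇓ (computes* gs xs) (computes f _)
  }

_⟨_⟩ᵈ : DecPred m → Vec (Fn k) m → DecPred k
P ⟨ gs ⟩ᵈ = record
  { pred    = λ xs → pred P (applies gs xs)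
  ; code    = compᶜ (DecPred.code P) (map Fn.code gs)
  ; decides = λ xs → lift xs (decides P (applies gs xs))
  }
  where
  lift : ∀ xs {A} → Decides (DecPred.code P) (applies gs xs) A →
         Decides (compᶜ (DecPred.code P) (map Fn.code gs)) xs A
  lift xs (inj₁ (p , d))  = inj₁ (p , comp⇓ (computes* gs xs) d)
  lift xs (inj₂ (¬p , d)) = inj₂ (¬p , comp⇓ (computes* gs xs) d)

mapᵈ : (P : DecPred k) {Q : Vec ℕ k → Set} → (∀ xs → pred P xs ⇔ Q xs) → DecPred k
mapᵈ P {Q} P⇔Q = record { pred = Q ; code = DecPred.code P ; decides = λ xs → lift xs (decides P xs) }
  where
  lift : ∀ xs → Decides (DecPred.code P) xs (pred P xs) → Decides (DecPred.code P) xs (Q xs)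
  lift xs (inj₁ (p , d))  = inj₁ (Equivalence.to (P⇔Q xs) p , d)
  lift xs (inj₂ (¬p , d)) = inj₂ (¬p ∘ Equivalence.from (P⇔Q xs) , d)

var : Fin k → Fn k
var i = record { apply = λ xs → lookup xs i ; code = projᶜ i ; computes = λ xs → proj⇓ i }

sucᶠ : Fn k → Fn k
sucᶠ f = record
  { apply    = λ xs → suc (apply f xs)
  ; code     = compᶜ sucᶜ (Fn.code f ∷ [])
  ; computes = λ xs → comp⇓ (computes f xs ∷ []) suc⇓
  }

const : ℕ → Fn k
const zero    = record { apply = λ _ → 0 ; code = zeroᶜ ; computes = λ _ → zero⇓ }
const (suc n) = sucᶠ (const n)

primrec : Fn k → Fn (2 + k) → Fn (1 + k)
primrec {k} f g = record { apply = go ; code = precᶜ (Fn.code f) (Fn.code g) ; computes = go⇓ }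
  where
  go : Vec ℕ (1 + k) → ℕ
  go (zero  ∷ xs) = apply f xs
  go (suc n ∷ xs) = apply g (n ∷ go (n ∷ xs) ∷ xs)
  go⇓ : ∀ xs → precᶜ (Fn.code f) (Fn.code g) [ xs ]⇓ go xs
  go⇓ (zero  ∷ xs) = precZ⇓ (computes f xs)
  go⇓ (suc n ∷ xs) = precS⇓ (go⇓ (n ∷ xs)) (computes g _)

recast : (f : Fn k) {g : Vec ℕ k → ℕ} → (∀ xs → apply f xs ≡ g xs) → Fn k
recast f {g} f≗g = record
  { apply    = g
  ; code     = Fn.code f
  ; computes = λ xs → subst (Fn.code f [ xs ]⇓_) (f≗g xs) (computes f xs)
  }

trueᵈ : DecPred k
trueᵈ = record
  { pred = λ _ → ⊤ ; code = Fn.code (const 1) ; decides = λ xs → inj₁ (tt , computes (const 1) xs) }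

caseᵈ : DecPred k → DecPred (1 + k) → DecPred (1 + k)
caseᵈ {k} P Q = record { pred = cases ; code = e ; decides = decide }
  where
  cases : Vec ℕ (1 + k) → Set
  cases (zero  ∷ xs) = pred P xs
  cases (suc n ∷ xs) = pred Q (n ∷ xs)
  e : Code (1 + k)
  e = precᶜ (DecPred.code P) (compᶜ (DecPred.code Q) dropSecond)
  decide : ∀ xs → Decides e xs (cases xs)
  decide (zero ∷ xs) with decides P xs
  ... | inj₁ (p , d)  = inj₁ (p , precZ⇓ d)
  ... | inj₂ (¬p , d) = inj₂ (¬p , precZ⇓ d)
  -- The step discards the previous value `r`, but `precS⇓` demands that it exist.
  decide (suc n ∷ xs) with value (decide (n ∷ xs)) | decides Q (n ∷ xs)
  ... | r , dr | inj₁ (q , d)  = inj₁ (q , precS⇓ dr (comp⇓ (dropSecond⇓ n r xs) d))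
  ... | r , dr | inj₂ (¬q , d) = inj₂ (¬q , precS⇓ dr (comp⇓ (dropSecond⇓ n r xs) d))

isZeroᵈ : DecPred 1
isZeroᵈ = record { pred = λ { (n ∷ []) → n ≡ 0 } ; code = e ; decides = decide }
  where
  e : Code 1
  e = precᶜ (Fn.code (const 1)) zeroᶜ
  e⇓ : ∀ n → ∃ λ y → e [ n ∷ [] ]⇓ y
  e⇓ zero    = 1 , precZ⇓ (computes (const 1) [])
  e⇓ (suc n) = 0 , precS⇓ (proj₂ (e⇓ n)) zero⇓
  decide : ∀ xs → Decides e xs _
  decide (zero  ∷ []) = inj₁ (refl , precZ⇓ (computes (const 1) []))
  decide (suc n ∷ []) = inj₂ ((λ ()) , precS⇓ (proj₂ (e⇓ n)) zero⇓)

character : DecPred k → Fn k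
character P = record
  { apply    = λ xs → proj₁ (value (decides P xs))
  ; code     = DecPred.code P
  ; computes = λ xs → proj₂ (value (decides P xs))
  }

character-yes : (P : DecPred k) → ∀ {xs} → pred P xs → apply (character P) xs ≡ 1
character-yes P {xs} p with decides P xs
... | inj₁ _        = refl
... | inj₂ (¬p , _) = contradiction p ¬p

character-no : (P : DecPred k) → ∀ {xs} → ¬ pred P xs → apply (character P) xs ≡ 0
character-no P {xs} ¬p with decides P xs
... | inj₁ (p , _) = contradiction p ¬p
... | inj₂ _       = refl

character≡0 : (P : DecPred k) → ∀ xs → apply (character P) xs ≡ 0 ⇔ (¬ pred P xs)
character≡0 P xs = mk⇔
  (λ eq p → 0≢1+n (trans (sym eq) (character-yes P p)))
  (character-no P)

infix  9 ¬ᵈ_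
infixr 6 _∧ᵈ_
infixr 5 _⇒ᵈ_
infixr 5 ∀<ᵈ_·_ ∃<ᵈ_·_

¬ᵈ_ : DecPred k → DecPred k
¬ᵈ P = mapᵈ (isZeroᵈ ⟨ character P ∷ [] ⟩ᵈ) (character≡0 P)

-- Recursion on the first argument: 0 gives 0, and a successor gives the second argument, which is
-- `projᶜ 2F` among the arguments of the step.
conjᶜ : Code 2
conjᶜ = precᶜ zeroᶜ (projᶜ 2F)

conj-yes⇓ : ∀ {y} → conjᶜ [ 1 ∷ y ∷ [] ]⇓ y
conj-yes⇓ = precS⇓ (precZ⇓ zero⇓) (proj⇓ 2F)

conj-no⇓ : ∀ {y} → conjᶜ [ 0 ∷ y ∷ [] ]⇓ 0
conj-no⇓ = precZ⇓ zero⇓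

_∧ᵈ_ : DecPred k → DecPred k → DecPred k
_∧ᵈ_ {k} P Q = record { pred = λ xs → pred P xs × pred Q xs ; code = e ; decides = decide }
  where
  e : Code k
  e = compᶜ conjᶜ (DecPred.code P ∷ DecPred.code Q ∷ [])
  decide : ∀ xs → Decides e xs (pred P xs × pred Q xs)
  decide xs with decides P xs | decides Q xs
  ... | inj₁ (p , d)  | inj₁ (q , d′)  = inj₁ ((p , q) , comp⇓ (d ∷ d′ ∷ []) conj-yes⇓)
  ... | inj₁ (p , d)  | inj₂ (¬q , d′) = inj₂ (¬q ∘ proj₂ , comp⇓ (d ∷ d′ ∷ []) conj-yes⇓)
  -- `compᶜ` evaluates both arguments, so `Q` must yield a value even where `P` already settles the
  -- conjunction.
  ... | inj₂ (¬p , d) | D with value D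
  ... | _ , d′ = inj₂ (¬p ∘ proj₁ , comp⇓ (d ∷ d′ ∷ []) conj-no⇓)

_⇒ᵈ_ : DecPred k → DecPred k → DecPred k
P ⇒ᵈ Q = mapᵈ (¬ᵈ (P ∧ᵈ ¬ᵈ Q)) λ xs → mk⇔
  (λ h p → decidable-stable (pred? Q xs) λ ¬q → h (p , ¬q))
  (λ f (p , ¬q) → ¬q (f p))

∀<ᵈ_·_ : Fn k → DecPred (1 + k) → DecPred k
∀<ᵈ_·_ {k} t P = record
  { pred    = λ xs → ∀ i → i < apply t xs → pred P (i ∷ xs)
  ; code    = compᶜ loop (Fn.code t ∷ allVars)
  ; decides = λ xs → lift xs (decide (apply t xs) xs)
  }
  where
  step : Vec (Code (2 + k)) 2
  step = projᶜ 1F ∷ compᶜ (DecPred.code P) dropSecond ∷ []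
  step⇓ : ∀ n xs {r s} → DecPred.code P [ n ∷ xs ]⇓ s → step [ n ∷ r ∷ xs ]⇓* (r ∷ s ∷ [])
  step⇓ n xs {r} d = proj⇓ 1F ∷ comp⇓ (dropSecond⇓ n r xs) d ∷ []
  loop : Code (1 + k)
  loop = precᶜ (Fn.code (const 1)) (compᶜ conjᶜ step)
  extend : ∀ {n xs} → (∀ i → i < n → pred P (i ∷ xs)) → pred P (n ∷ xs) →
           ∀ i → i < suc n → pred P (i ∷ xs)
  extend below last i i<1+n with m<1+n⇒m<n∨m≡n i<1+n
  ... | inj₁ i<n  = below i i<n
  ... | inj₂ refl = last
  decide : ∀ n xs → Decides loop (n ∷ xs) (∀ i → i < n → pred P (i ∷ xs))
  decide zero xs = inj₁ ((λ _ ()) , precZ⇓ (computes (const 1) xs))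
  decide (suc n) xs with decide n xs | decides P (n ∷ xs)
  ... | inj₁ (p , d) | inj₁ (q , d′) =
    inj₁ (extend p q , precS⇓ d (comp⇓ (step⇓ n xs d′) conj-yes⇓))
  ... | inj₁ (p , d) | inj₂ (¬q , d′) =
    inj₂ ((λ h → ¬q (h n ≤-refl)) , precS⇓ d (comp⇓ (step⇓ n xs d′) conj-yes⇓))
  ... | inj₂ (¬p , d) | D with value D
  ... | _ , d′ =
    inj₂ ((λ h → ¬p λ i i<n → h i (m<n⇒m<1+n i<n)) , precS⇓ d (comp⇓ (step⇓ n xs d′) conj-no⇓))
  lift : ∀ xs {A} → Decides loop (apply t xs ∷ xs) A → Decides (compᶜ loop (Fn.code t ∷ allVars)) xs A
  lift xs (inj₁ (a , d))  = inj₁ (a , comp⇓ (computes t xs ∷ allVars⇓ xs) d)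
  lift xs (inj₂ (¬a , d)) = inj₂ (¬a , comp⇓ (computes t xs ∷ allVars⇓ xs) d)

∃<ᵈ_·_ : Fn k → DecPred (1 + k) → DecPred k
∃<ᵈ t · P = mapᵈ (¬ᵈ (∀<ᵈ t · ¬ᵈ P)) λ xs → mk⇔
  (λ h → decidable-stable (anyUpTo? (λ i → pred? P (i ∷ xs)) (apply t xs))
           λ none → h λ i i<t p → none (i , i<t , p))
  (λ (i , i<t , p) h → h i i<t p)

-- `muᶜ` looks for the value 0, which a deciding program returns for falsity; hence the negation.
search : DecPred (1 + k) → Code k
search P = muᶜ (DecPred.code (¬ᵈ P))

search-finds : (P : DecPred (1 + k)) → ∀ {xs y} →
               pred P (y ∷ xs) → (∀ i → i < y → ¬ pred P (i ∷ xs)) → search P [ xs ]⇓ y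
search-finds P Py least-y = mu⇓
  (λ i i<y → 0 , if-yes (decides (¬ᵈ P) _) (least-y i i<y))
  (if-no (decides (¬ᵈ P) _) λ ¬Py → ¬Py Py)

search-sound : (P : DecPred (1 + k)) → ∀ {xs y} → search P [ xs ]⇓ y → pred P (y ∷ xs)
search-sound P {xs} {y} (mu⇓ _ d) = decidable-stable (pred? P (y ∷ xs)) λ ¬Py →
  0≢1+n (⇓-functional d (if-yes (decides (¬ᵈ P) _) ¬Py))

minimise : (P : DecPred (1 + k)) → (∀ xs → ∃ λ i → pred P (i ∷ xs)) → Fn k
minimise {k} P total = record
  { apply    = λ xs → proj₁ (min xs)
  ; code     = search P
  ; computes = λ xs → search-finds P (proj₁ (proj₂ (min xs))) (proj₂ (proj₂ (min xs)))
  }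
  where
  min : (xs : Vec ℕ k) → _
  min xs = least (λ i → pred? P (i ∷ xs)) (proj₁ (total xs)) (proj₂ (total xs))

minimise-sound : (P : DecPred (1 + k)) (total : ∀ xs → ∃ λ i → pred P (i ∷ xs)) →
                 ∀ xs → pred P (apply (minimise P total) xs ∷ xs)
minimise-sound P total xs = search-sound P (computes (minimise P total) xs)

minimise-≤ : (P : DecPred (1 + k)) (total : ∀ xs → ∃ λ i → pred P (i ∷ xs)) →
             ∀ {xs i} → pred P (i ∷ xs) → apply (minimise P total) xs ≤ i
minimise-≤ P total {xs} {i} Pi = ≮⇒≥ λ i<min →
  proj₂ (proj₂ (least (λ i → pred? P (i ∷ xs)) (proj₁ (total xs)) (proj₂ (total xs)))) i i<min Pi

-- Arithmetic and comparison

plus : Fn 2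
plus = recast (primrec (var 0F) (sucᶠ (var 1F))) {λ xs → lookup xs 0F + lookup xs 1F} correct
  where
  correct : ∀ xs → _
  correct (zero  ∷ y ∷ []) = refl
  correct (suc x ∷ y ∷ []) = cong suc (correct (x ∷ y ∷ []))

infixl 7 _+ᶠ_ _∸ᶠ_
infixl 8 _*ᶠ_

_+ᶠ_ : Fn k → Fn k → Fn k
f +ᶠ g = plus ⟨ f ∷ g ∷ [] ⟩ᶠ

times : Fn 2
times = recast (primrec (const 0) (var 2F +ᶠ var 1F)) {λ xs → lookup xs 0F * lookup xs 1F} correct
  where
  correct : ∀ xs → _
  correct (zero  ∷ y ∷ []) = refl
  correct (suc x ∷ y ∷ []) = cong (y +_) (correct (x ∷ y ∷ []))

_*ᶠ_ : Fn k → Fn k → Fn k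
f *ᶠ g = times ⟨ f ∷ g ∷ [] ⟩ᶠ

predecessor : Fn 1
predecessor = recast (primrec (const 0) (var 0F)) {λ xs → ℕ.pred (lookup xs 0F)} correct
  where
  correct : ∀ xs → _
  correct (zero  ∷ []) = refl
  correct (suc n ∷ []) = refl

monus : Fn 2
monus = recast (primrec (var 0F) (predecessor ⟨ var 1F ∷ [] ⟩ᶠ)) {λ xs → lookup xs 1F ∸ lookup xs 0F} correct
  where
  correct : ∀ xs → _
  correct (zero  ∷ y ∷ []) = refl
  correct (suc x ∷ y ∷ []) = trans (cong ℕ.pred (correct (x ∷ y ∷ []))) (pred[m∸n]≡m∸[1+n] y x)

_∸ᶠ_ : Fn k → Fn k → Fn k
f ∸ᶠ g = monus ⟨ g ∷ f ∷ [] ⟩ᶠ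

infix 7 _≤ᵈ_ _<ᵈ_ _≡ᵈ_

_≤ᵈ_ : Fn k → Fn k → DecPred k
f ≤ᵈ g = mapᵈ (isZeroᵈ ⟨ f ∸ᶠ g ∷ [] ⟩ᵈ) λ xs →
  mk⇔ (m∸n≡0⇒m≤n {apply f xs} {apply g xs}) (m≤n⇒m∸n≡0 {apply f xs} {apply g xs})

_<ᵈ_ : Fn k → Fn k → DecPred k
f <ᵈ g = sucᶠ f ≤ᵈ g

_≡ᵈ_ : Fn k → Fn k → DecPred k
f ≡ᵈ g = mapᵈ (f ≤ᵈ g ∧ᵈ g ≤ᵈ f) λ xs →
  mk⇔ (λ (f≤g , g≤f) → ≤-antisym {apply f xs} {apply g xs} f≤g g≤f)
      (λ eq → ≤-reflexive eq , ≤-reflexive (sym eq))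

-- A universal enumeration of the c.e. sets

opaque
  -- A variant of the Cantor pairing without halving. As `a ≤ a + b`, the value lies between the
  -- squares of `a + b` and `a + b + 1`, whence injectivity. It is not surjective, so genuine pairs
  -- are recognised by `x ≡ pair (fst x) (snd x)`.
  pair : ℕ → ℕ → ℕ
  pair a b = (a + b) * (a + b) + a

  private
    pair-mono-+ : a + b < c + d → pair a b < pair c d
    pair-mono-+ {a} {b} {c} {d} lt = begin-strict
      s * s + a           ≤⟨ +-monoʳ-≤ (s * s) (m≤m+n a b) ⟩
      s * s + s           ≡⟨ +-comm (s * s) s ⟩
      suc s * s           <⟨ *-monoʳ-< (suc s) (n<1+n s) ⟩
      suc s * suc s       ≤⟨ *-mono-≤ lt lt ⟩
      (c + d) * (c + d)   ≤⟨ m≤m+n _ c ⟩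
      pair c d            ∎
      where
      open ≤-Reasoning
      s : ℕ
      s = a + b

  pair-injective : pair a b ≡ pair c d → a ≡ c × b ≡ d
  pair-injective {a} {b} {c} {d} eq with <-cmp (a + b) (c + d)
  ... | tri< lt _ _ = contradiction eq (<⇒≢ (pair-mono-+ {a} {b} {c} {d} lt))
  ... | tri> _ _ gt = contradiction (sym eq) (<⇒≢ (pair-mono-+ {c} {d} {a} {b} gt))
  ... | tri≈ _ s≡t _ with +-cancelˡ-≡ ((a + b) * (a + b)) a c (trans eq (cong (λ s → s * s + c) (sym s≡t)))
  ... | refl = refl , +-cancelˡ-≡ a b d s≡t

  m≤pair : ∀ m n → m ≤ pair m n
  m≤pair m n = m≤n+m m _

  n≤pair : ∀ m n → n ≤ pair m n
  n≤pair m n = ≤-trans (m≤n+m n m) (≤-trans (m≤m*m (m + n)) (m≤m+n _ m))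
    where
    m≤m*m : ∀ m → m ≤ m * m
    m≤m*m zero    = z≤n
    m≤m*m (suc m) = m≤m*n (suc m) (suc m)

  -- Entries of coded lists are stored as successors, so a code strictly exceeds that of its tail;
  -- hence the code of a list bounds the positions in it.
  n<pair-suc : ∀ m n → n < pair (suc m) n
  n<pair-suc m n = s≤s (≤-trans (m≤n+m n m) (≤-trans (m≤m+n _ _) (m≤m+n _ _)))

  pair-0-0 : pair 0 0 ≡ 0
  pair-0-0 = refl

  pair-computes : ∀ (xs : Vec ℕ 2) →
    apply ((var 0F +ᶠ var 1F) *ᶠ (var 0F +ᶠ var 1F) +ᶠ var 0F) xs ≡ pair (lookup xs 0F) (lookup xs 1F)
  pair-computes xs = refl

pairᶠ : Fn k → Fn k → Fn k
pairᶠ f g = recast ((var 0F +ᶠ var 1F) *ᶠ (var 0F +ᶠ var 1F) +ᶠ var 0F)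
                   {λ xs → pair (lookup xs 0F) (lookup xs 1F)} pair-computes ⟨ f ∷ g ∷ [] ⟩ᶠ

-- The antecedent a < n makes the projections total: both are n when n is not a pair.
fstGraph sndGraph : DecPred 2
fstGraph = var 0F <ᵈ var 1F ⇒ᵈ ∃<ᵈ sucᶠ (var 1F) · var 2F ≡ᵈ pairᶠ (var 1F) (var 0F)
sndGraph = var 0F <ᵈ var 1F ⇒ᵈ ∃<ᵈ sucᶠ (var 1F) · var 2F ≡ᵈ pairᶠ (var 0F) (var 1F)

fstGraph-total : ∀ xs → ∃ λ a → pred fstGraph (a ∷ xs)
fstGraph-total (n ∷ []) = n , λ n<n → contradiction n<n (<-irrefl refl)

sndGraph-total : ∀ xs → ∃ λ b → pred sndGraph (b ∷ xs)
sndGraph-total (n ∷ []) = n , λ n<n → contradiction n<n (<-irrefl refl)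

opaque
  fst snd : ℕ → ℕ
  fst n = apply (minimise fstGraph fstGraph-total) (n ∷ [])
  snd n = apply (minimise sndGraph sndGraph-total) (n ∷ [])

  fst-computes : ∀ (xs : Vec ℕ 1) → apply (minimise fstGraph fstGraph-total) xs ≡ fst (lookup xs 0F)
  fst-computes (n ∷ []) = refl

  snd-computes : ∀ (xs : Vec ℕ 1) → apply (minimise sndGraph sndGraph-total) xs ≡ snd (lookup xs 0F)
  snd-computes (n ∷ []) = refl

  fst-minimal : ∀ {n i} → pred fstGraph (i ∷ n ∷ []) → fst n ≤ i
  fst-minimal {n} = minimise-≤ fstGraph fstGraph-total {n ∷ []}

  snd-minimal : ∀ {n i} → pred sndGraph (i ∷ n ∷ []) → snd n ≤ i
  snd-minimal {n} = minimise-≤ sndGraph sndGraph-total {n ∷ []}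

  fst-sound : ∀ n → pred fstGraph (fst n ∷ n ∷ [])
  fst-sound n = minimise-sound fstGraph fstGraph-total (n ∷ [])

  snd-sound : ∀ n → pred sndGraph (snd n ∷ n ∷ [])
  snd-sound n = minimise-sound sndGraph sndGraph-total (n ∷ [])

fst≤ : ∀ n → fst n ≤ n
fst≤ n = fst-minimal λ n<n → contradiction n<n (<-irrefl refl)

snd≤ : ∀ n → snd n ≤ n
snd≤ n = snd-minimal λ n<n → contradiction n<n (<-irrefl refl)

fst-pair : ∀ a b → fst (pair a b) ≡ a
fst-pair a b with m≤n⇒m<n∨m≡n (fst-minimal {pair a b} {a} λ _ → b , s≤s (n≤pair a b) , refl)
... | inj₂ eq = eq
-- A value below `a` is below the pair as well, so the antecedent of the graph holds and yields a
-- true decomposition, to which injectivity applies.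
... | inj₁ lt with fst-sound (pair a b) (<-≤-trans lt (m≤pair a b))
... | _ , _ , eq = sym (proj₁ (pair-injective eq))

snd-pair : ∀ a b → snd (pair a b) ≡ b
snd-pair a b with m≤n⇒m<n∨m≡n (snd-minimal {pair a b} {b} λ _ → a , s≤s (m≤pair a b) , refl)
... | inj₂ eq = eq
... | inj₁ lt with snd-sound (pair a b) (<-≤-trans lt (n≤pair a b))
... | _ , _ , eq = sym (proj₂ (pair-injective eq))

fstᶠ sndᶠ : Fn k → Fn k
fstᶠ f = recast (minimise fstGraph fstGraph-total) {λ xs → fst (lookup xs 0F)} fst-computes ⟨ f ∷ [] ⟩ᶠ
sndᶠ f = recast (minimise sndGraph sndGraph-total) {λ xs → snd (lookup xs 0F)} snd-computes ⟨ f ∷ [] ⟩ᶠ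

-- Finite lists as numbers: the entries w are stored as suc w, so that 0 is
-- an end marker (note pair 0 0 ≡ 0).
tails : ℕ → ℕ → ℕ
tails zero    u = u
tails (suc j) u = snd (tails j u)

tailsᶠ : Fn k → Fn k → Fn k
tailsᶠ f g = recast (primrec (var 0F) (sndᶠ (var 1F))) {λ xs → tails (lookup xs 0F) (lookup xs 1F)} correct
               ⟨ f ∷ g ∷ [] ⟩ᶠ
  where
  correct : ∀ (xs : Vec ℕ 2) → _
  correct (zero  ∷ u ∷ []) = refl
  correct (suc j ∷ u ∷ []) = cong snd (correct (j ∷ u ∷ []))

tails≤ : ∀ j u → tails j u ≤ u
tails≤ zero    u = ≤-refl
tails≤ (suc j) u = ≤-trans (snd≤ (tails j u)) (tails≤ j u)




memberᵈ : DecPred 2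
memberᵈ = ∃<ᵈ sucᶠ (var 1F) · fstᶠ (tailsᶠ (var 0F) (var 2F)) ≡ᵈ sucᶠ (var 1F)

opaque
  Member : ℕ → ℕ → Set
  Member w u = pred memberᵈ (w ∷ u ∷ [])

  member-entry : ∀ {w u} → Member w u → ∃ λ j → j < suc u × fst (tails j u) ≡ suc w
  member-entry M = M

  entry-member : ∀ {w u} j → j < suc u → fst (tails j u) ≡ suc w → Member w u
  entry-member j j≤u eq = j , j≤u , eq

member< : ∀ {w u} → Member w u → w < u
member< {w} {u} M = let j , _ , eq = member-entry M in
  subst (_≤ u) eq (≤-trans (fst≤ (tails j u)) (tails≤ j u))

encode : List ℕ → ℕ
encode List.[]       = 0
encode (w List.∷ ws) = pair (suc w) (encode ws)

snd-encode : ∀ ws → snd (encode ws) ≡ encode (List.drop 1 ws)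
snd-encode List.[]       = trans (cong snd (sym pair-0-0)) (snd-pair 0 0)
snd-encode (w List.∷ ws) = snd-pair _ _

drop-suc : ∀ {A : Set} j (ws : List A) → List.drop 1 (List.drop j ws) ≡ List.drop (suc j) ws
drop-suc zero    ws              = refl
drop-suc (suc j) List.[]         = refl
drop-suc (suc j) (w List.∷ ws)   = drop-suc j ws

tails-encode : ∀ j ws → tails j (encode ws) ≡ encode (List.drop j ws)
tails-encode zero    ws = refl
tails-encode (suc j) ws = begin
  snd (tails j (encode ws))             ≡⟨ cong snd (tails-encode j ws) ⟩
  snd (encode (List.drop j ws))         ≡⟨ snd-encode (List.drop j ws) ⟩
  encode (List.drop 1 (List.drop j ws)) ≡⟨ cong encode (drop-suc j ws) ⟩
  encode (List.drop (suc j) ws)         ∎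
  where open ≡-Reasoning

member-encode : ∀ {w ws} → w ∈ₗ ws → Member w (encode ws)
member-encode {w} {ws} w∈ws = entry-member j (s≤s j≤) (begin
  fst (tails j (encode ws))        ≡⟨ cong fst (tails-encode j ws) ⟩
  fst (encode (List.drop j ws))    ≡⟨ cong (fst ∘ encode) eq ⟩
  fst (pair (suc w) (encode rest)) ≡⟨ fst-pair _ _ ⟩
  suc w                            ∎)
  where
  open ≡-Reasoning
  position : ∀ {ws} → w ∈ₗ ws → ∃₂ λ j rest → j ≤ encode ws × List.drop j ws ≡ w List.∷ rest
  position (here refl) = 0 , _ , z≤n , refl
  position (there {x} {xs} w∈xs) with position w∈xs
  ... | j , rest , j≤ , eq = suc j , rest , ≤-<-trans j≤ (n<pair-suc _ _) , eq
  found = position w∈ws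
  j = proj₁ found
  rest = proj₁ (proj₂ found)
  j≤ = proj₁ (proj₂ (proj₂ found))
  eq = proj₂ (proj₂ (proj₂ found))

-- A fact says that the program numbered e yields y on the input x.
fact : ℕ → ℕ → ℕ → ℕ
fact e x y = pair e (pair x y)

factᵈ : Fn k → Fn k → Fn k → Fn k → DecPred k
factᵈ e x y u = memberᵈ ⟨ pairᶠ e (pairᶠ x y) ∷ u ∷ [] ⟩ᵈ

-- Primitive recursion at the argument n; the other arguments are those of rule
-- after the tag.
precRule : DecPred 5
precRule =
  caseᵈ (factᵈ (fstᶠ (var 0F)) (sndᶠ (var 1F)) (var 2F) (var 3F))
        (∃<ᵈ var 4F ·
          factᵈ (pairᶠ (const 4) (var 2F)) (pairᶠ (var 1F) (sndᶠ (var 3F))) (var 0F) (var 5F)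
          ∧ᵈ factᵈ (sndᶠ (var 2F)) (pairᶠ (var 1F) (pairᶠ (var 0F) (sndᶠ (var 3F)))) (var 4F) (var 5F))

-- The arguments t , p , x , y , u of the rule: the fact fact (pair t p) x y is
-- justified by the facts in u, t being the tag of the program constructor.
-- Lists of programs (tags 6 and 7) are programs with list output.
rule : DecPred 5
rule =
  caseᵈ (var 2F ≡ᵈ const 0) $
  caseᵈ (var 2F ≡ᵈ sucᶠ (fstᶠ (var 1F))) $
  -- The inner distinction is on the index of the projection: a positive index is justified by its
  -- predecessor on the rest of the input.
  caseᵈ (caseᵈ (var 1F ≡ᵈ fstᶠ (var 0F))
               (factᵈ (pairᶠ (const 2) (var 0F)) (sndᶠ (var 1F)) (var 2F) (var 3F))) $
  caseᵈ (∃<ᵈ var 3F · factᵈ (sndᶠ (var 1F)) (var 2F) (var 0F) (var 4F)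
                    ∧ᵈ factᵈ (fstᶠ (var 1F)) (var 0F) (var 3F) (var 4F)) $
  caseᵈ (precRule ⟨ fstᶠ (var 1F) ∷ var 0F ∷ var 1F ∷ var 2F ∷ var 3F ∷ [] ⟩ᵈ) $
  caseᵈ ((∀<ᵈ var 2F · ∃<ᵈ var 4F ·
           factᵈ (var 2F) (pairᶠ (var 1F) (var 3F)) (sucᶠ (var 0F)) (var 5F))
         ∧ᵈ factᵈ (var 0F) (pairᶠ (var 2F) (var 1F)) (const 0) (var 3F)) $
  caseᵈ (var 2F ≡ᵈ const 0)
        -- This branch serves all tags from 7 on and still carries the tag, less 7, as `var 0F`;
        -- hence the indices are one higher than in the branches above.
        (factᵈ (fstᶠ (var 1F)) (var 2F) (fstᶠ (var 3F)) (var 4F)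
         ∧ᵈ factᵈ (sndᶠ (var 1F)) (var 2F) (sndᶠ (var 3F)) (var 4F)
         ∧ᵈ var 3F ≡ᵈ pairᶠ (fstᶠ (var 3F)) (sndᶠ (var 3F)))

opaque
  Rule : (t p x y u : ℕ) → Set
  Rule t p x y u = pred rule (t ∷ p ∷ x ∷ y ∷ u ∷ [])

justified : DecPred 2
justified = rule ⟨ fstᶠ (fstᶠ (var 0F)) ∷ sndᶠ (fstᶠ (var 0F)) ∷
                   fstᶠ (sndᶠ (var 0F)) ∷ sndᶠ (sndᶠ (var 0F)) ∷ var 1F ∷ [] ⟩ᵈ

opaque
  Justified : ℕ → ℕ → Set
  Justified w u = pred justified (w ∷ u ∷ [])

-- A justification refers to subprograms, or to the same construct at a smaller
-- argument, so that a finite set of facts closed under it contains only true facts.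
closed : DecPred 1
closed = ∀<ᵈ sucᶠ (var 0F) · caseᵈ trueᵈ justified ⟨ fstᶠ (tailsᶠ (var 0F) (var 1F)) ∷ var 1F ∷ [] ⟩ᵈ

Closed : ℕ → Set
Closed u = pred closed (u ∷ [])

rule-cong : ∀ {t t′ p p′ x x′ y y′} u → t ≡ t′ → p ≡ p′ → x ≡ x′ → y ≡ y′ →
            Rule t p x y u ≡ Rule t′ p′ x′ y′ u
rule-cong u refl refl refl refl = refl

opaque
  unfolding Justified Rule

  justified-fact : ∀ t p x y u → Justified (fact (pair t p) x y) u ≡ Rule t p x y u
  justified-fact t p x y u = rule-cong u
    (trans (cong fst (fst-pair (pair t p) (pair x y))) (fst-pair t p))
    (trans (cong snd (fst-pair (pair t p) (pair x y))) (snd-pair t p))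
    (trans (cong fst (snd-pair (pair t p) (pair x y))) (fst-pair x y))
    (trans (cong snd (snd-pair (pair t p) (pair x y))) (snd-pair x y))

  closed-rule : ∀ {t p x y u} → Closed u → Member (fact (pair t p) x y) u → Rule t p x y u
  closed-rule {t} {p} {x} {y} {u} closed-u F = let j , j≤ , eq = member-entry F in
    subst (λ A → A) (justified-fact t p x y u)
    (subst (λ w → pred (caseᵈ trueᵈ justified) (w ∷ u ∷ [])) eq (closed-u j j≤))

  all-justified⇒closed : ∀ {ws} → All (λ w → Justified w (encode ws)) ws → Closed (encode ws)
  all-justified⇒closed {ws} all j _ = subst (λ w → pred (caseᵈ trueᵈ justified) (w ∷ encode ws ∷ []))
    (cong fst (sym (tails-encode j ws))) (first (drop⁺ j all))
    where
    first : ∀ {vs} → All (λ w → Justified w (encode ws)) vs →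
            pred (caseᵈ trueᵈ justified) (fst (encode vs) ∷ encode ws ∷ [])
    -- Past the end of the list the tail is 0, which is `pair 0 0`; its first component is the end
    -- marker, accepted by `trueᵈ`.
    first [] = subst (λ w → pred (caseᵈ trueᵈ justified) (w ∷ encode ws ∷ []))
                 (sym (trans (cong fst (sym pair-0-0)) (fst-pair 0 0))) tt
    first (w-justified ∷ _) = subst (λ w → pred (caseᵈ trueᵈ justified) (w ∷ encode ws ∷ []))
                 (sym (fst-pair _ _)) w-justified

-- Numbering of programs; closed tables contain only true facts

⌜_⌝ : Code k → ℕ
⌜_⌝* : Vec (Code k) m → ℕ
⌜ zeroᶜ ⌝      = pair 0 0
⌜ sucᶜ ⌝       = pair 1 0
⌜ projᶜ i ⌝    = pair 2 (toℕ i)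
⌜ compᶜ f gs ⌝ = pair 3 (pair ⌜ f ⌝ ⌜ gs ⌝*)
⌜ precᶜ f g ⌝  = pair 4 (pair ⌜ f ⌝ ⌜ g ⌝)
⌜ muᶜ f ⌝      = pair 5 ⌜ f ⌝
⌜ [] ⌝*        = pair 6 0
⌜ g ∷ gs ⌝*    = pair 7 (pair ⌜ g ⌝ ⌜ gs ⌝*)

inputs : Vec ℕ k → ℕ
inputs []       = 0
inputs (x ∷ xs) = pair x (inputs xs)

module Soundness {u} (closed-u : Closed u) where

  Fact : ℕ → ℕ → ℕ → Set
  Fact e x y = Member (fact e x y) u

  opaque
    unfolding Member Rule

    zero-inv : ∀ {p x y} → Fact (pair 0 p) x y → y ≡ 0
    zero-inv F = closed-rule closed-u F

    suc-inv : ∀ {p x xs y} → Fact (pair 1 p) (pair x xs) y → y ≡ suc x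
    suc-inv {x = x} {xs} F = trans (closed-rule closed-u F) (cong suc (fst-pair x xs))

    proj-zero-inv : ∀ {x xs y} → Fact (pair 2 0) (pair x xs) y → y ≡ x
    proj-zero-inv {x} {xs} F = trans (closed-rule closed-u F) (fst-pair x xs)

    proj-suc-inv : ∀ {i x xs y} → Fact (pair 2 (suc i)) (pair x xs) y → Fact (pair 2 i) xs y
    proj-suc-inv {i} {x} {xs} {y} F =
      subst (λ v → Fact (pair 2 i) v y) (snd-pair x xs) (closed-rule closed-u F)

    comp-inv : ∀ {f gs x y} → Fact (pair 3 (pair f gs)) x y → ∃ λ v → Fact gs x v × Fact f v y
    comp-inv {f} {gs} {x} {y} F =
      let v , _ , Fgs , Ff = closed-rule closed-u F in
      v , subst (λ e → Fact e x v) (snd-pair f gs) Fgs , subst (λ e → Fact e v y) (fst-pair f gs) Ff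

    prec-zero-inv : ∀ {f g xs y} → Fact (pair 4 (pair f g)) (pair 0 xs) y → Fact f xs y
    prec-zero-inv {f} {g} {xs} {y} F =
      subst₂ (λ e v → Fact e v y) (fst-pair f g) (snd-pair 0 xs)
        (subst (λ n → pred precRule (n ∷ pair f g ∷ pair 0 xs ∷ y ∷ u ∷ []))
          (fst-pair 0 xs) (closed-rule closed-u F))

    prec-suc-inv : ∀ {f g n xs y} → Fact (pair 4 (pair f g)) (pair (suc n) xs) y →
                   ∃ λ r → Fact (pair 4 (pair f g)) (pair n xs) r × Fact g (pair n (pair r xs)) y
    prec-suc-inv {f} {g} {n} {xs} {y} F =
      let r , _ , Fr , Fg = subst (λ n → pred precRule (n ∷ pair f g ∷ pair (suc _) xs ∷ y ∷ u ∷ []))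
                              (fst-pair (suc n) xs) (closed-rule closed-u F) in
      r , subst (λ v → Fact (pair 4 (pair f g)) (pair n v) r) (snd-pair (suc n) xs) Fr
        , subst₂ (λ e v → Fact e (pair n (pair r v)) y) (snd-pair f g) (snd-pair (suc n) xs) Fg

    mu-inv : ∀ {f x y} → Fact (pair 5 f) x y →
             (∀ i → i < y → ∃ λ z → Fact f (pair i x) (suc z)) × Fact f (pair y x) 0
    mu-inv {f} {x} {y} F =
      let below , F₀ = closed-rule closed-u F in
      (λ i i<y → let z , _ , Fz = below i i<y in z , Fz) , F₀

    cons-inv : ∀ {g gs x y} → Fact (pair 7 (pair g gs)) x y →
               ∃₂ λ z zs → Fact g x z × Fact gs x zs × y ≡ pair z zs
    cons-inv {g} {gs} {x} {y} F =
      let Fg , Fgs , eq = closed-rule closed-u F in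
      fst y , snd y , subst (λ e → Fact e x (fst y)) (fst-pair g gs) Fg
                    , subst (λ e → Fact e x (snd y)) (snd-pair g gs) Fgs , eq

    nil-inv : ∀ {p x y} → Fact (pair 6 p) x y → y ≡ 0
    nil-inv F = closed-rule closed-u F

  -- A closed table may also contain facts about numbers that code no program. The induction follows
  -- `e`, so only facts about `e` and its subprograms are inverted and no number has to be decoded.
  sound  : ∀ (e : Code k) xs {y} → Fact ⌜ e ⌝ (inputs xs) y → e [ xs ]⇓ y
  sound* : ∀ (gs : Vec (Code k) m) xs {y} → Fact ⌜ gs ⌝* (inputs xs) y →
           ∃ λ ys → y ≡ inputs ys × gs [ xs ]⇓* ys

  sound zeroᶜ xs F = subst (zeroᶜ [ xs ]⇓_) (sym (zero-inv F)) zero⇓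
  sound sucᶜ (x ∷ []) F = subst (sucᶜ [ x ∷ [] ]⇓_) (sym (suc-inv F)) suc⇓
  sound (projᶜ i) xs F = subst (projᶜ i [ xs ]⇓_) (sym (proj-sound i xs F)) (proj⇓ i)
    where
    proj-sound : ∀ {k} (i : Fin k) xs {y} → Fact ⌜ projᶜ i ⌝ (inputs xs) y → y ≡ lookup xs i
    proj-sound zero    (x ∷ xs) F = proj-zero-inv F
    proj-sound (suc i) (x ∷ xs) F = proj-sound i xs (proj-suc-inv F)
  sound (compᶜ f gs) xs {y} F =
    let v , Fgs , Ff = comp-inv F
        ys , v≡ys , ds = sound* gs xs Fgs
    in comp⇓ ds (sound f ys (subst (λ v → Fact ⌜ f ⌝ v y) v≡ys Ff))
  sound (precᶜ f g) (n ∷ xs) F = prec-sound n F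
    where
    prec-sound : ∀ n {y} → Fact ⌜ precᶜ f g ⌝ (inputs (n ∷ xs)) y → precᶜ f g [ n ∷ xs ]⇓ y
    prec-sound zero    F = precZ⇓ (sound f xs (prec-zero-inv F))
    prec-sound (suc n) F = let r , Fr , Fg = prec-suc-inv F in
      precS⇓ (prec-sound n Fr) (sound g (n ∷ r ∷ xs) Fg)
  sound (muᶜ f) xs {y} F = let below , F₀ = mu-inv F in
    mu⇓ (λ i i<y → let z , Fz = below i i<y in z , sound f (i ∷ xs) Fz) (sound f (y ∷ xs) F₀)

  sound* [] xs F = [] , nil-inv F , []
  sound* (g ∷ gs) xs {y} F =
    let z , zs , Fg , Fgs , eq = cons-inv F
        ys , zs≡ys , ds = sound* gs xs Fgs
    in z ∷ ys , trans eq (cong (pair z) zs≡ys) , sound g xs Fg ∷ ds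

-- Every halting computation has a closed table

module Introduction (u : ℕ) where

  Fact : ℕ → ℕ → ℕ → Set
  Fact e x y = Member (fact e x y) u

  -- This is why `rule` may bound its existential quantifiers by the table: an output is nested
  -- inside the code of a fact, and members lie below the table.
  output< : ∀ {e x y} → Fact e x y → y < u
  output< {e} {x} {y} F = ≤-<-trans (≤-trans (n≤pair x y) (n≤pair e (pair x y))) (member< F)

  opaque
    unfolding Member Rule

    zero-intro : ∀ {p x} → Rule 0 p x 0 u
    zero-intro = refl

    suc-intro : ∀ {p x xs} → Rule 1 p (pair x xs) (suc x) u
    suc-intro {x = x} {xs} = cong suc (sym (fst-pair x xs))

    proj-zero-intro : ∀ {x xs} → Rule 2 0 (pair x xs) x u
    proj-zero-intro {x} {xs} = sym (fst-pair x xs)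

    proj-suc-intro : ∀ {i x xs y} → Fact (pair 2 i) xs y → Rule 2 (suc i) (pair x xs) y u
    proj-suc-intro {i} {x} {xs} {y} = subst (λ v → Fact (pair 2 i) v y) (sym (snd-pair x xs))

    comp-intro : ∀ {f gs x v y} → Fact gs x v → Fact f v y → Rule 3 (pair f gs) x y u
    comp-intro {f} {gs} {x} {v} {y} Fgs Ff =
      v , output< Fgs , subst (λ e → Fact e x v) (sym (snd-pair f gs)) Fgs
                      , subst (λ e → Fact e v y) (sym (fst-pair f gs)) Ff

    prec-zero-intro : ∀ {f g xs y} → Fact f xs y → Rule 4 (pair f g) (pair 0 xs) y u
    prec-zero-intro {f} {g} {xs} {y} F =
      subst (λ n → pred precRule (n ∷ pair f g ∷ pair 0 xs ∷ y ∷ u ∷ [])) (sym (fst-pair 0 xs))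
        (subst₂ (λ e v → Fact e v y) (sym (fst-pair f g)) (sym (snd-pair 0 xs)) F)

    prec-suc-intro : ∀ {f g n xs r y} → Fact (pair 4 (pair f g)) (pair n xs) r →
                     Fact g (pair n (pair r xs)) y → Rule 4 (pair f g) (pair (suc n) xs) y u
    prec-suc-intro {f} {g} {n} {xs} {r} {y} Fr Fg =
      subst (λ m → pred precRule (m ∷ pair f g ∷ pair (suc n) xs ∷ y ∷ u ∷ [])) (sym (fst-pair (suc n) xs))
        ( r , output< Fr
        , subst (λ v → Fact (pair 4 (pair f g)) (pair n v) r) (sym (snd-pair (suc n) xs)) Fr
        , subst₂ (λ e v → Fact e (pair n (pair r v)) y) (sym (snd-pair f g)) (sym (snd-pair (suc n) xs)) Fg)

    mu-intro : ∀ {f x y} → (∀ i → i < y → ∃ λ z → Fact f (pair i x) (suc z)) → Fact f (pair y x) 0 →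
               Rule 5 f x y u
    mu-intro {f} {x} {y} below F₀ =
      (λ i i<y → let z , Fz = below i i<y in z , <-trans (n<1+n z) (output< Fz) , Fz) , F₀

    cons-intro : ∀ {g gs x z zs} → Fact g x z → Fact gs x zs → Rule 7 (pair g gs) x (pair z zs) u
    cons-intro {g} {gs} {x} {z} {zs} Fg Fgs =
      subst₂ (λ e y → Fact e x y) (sym (fst-pair g gs)) (sym (fst-pair z zs)) Fg ,
      subst₂ (λ e y → Fact e x y) (sym (snd-pair g gs)) (sym (snd-pair z zs)) Fgs ,
      sym (cong₂ pair (fst-pair z zs) (snd-pair z zs))

    nil-intro : ∀ {p x} → Rule 6 p x 0 u
    nil-intro = refl

open Introduction using (zero-intro; suc-intro; proj-zero-intro; proj-suc-intro; comp-intro;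
  prec-zero-intro; prec-suc-intro; mu-intro; cons-intro; nil-intro)

Holding : ℕ → List ℕ → Set
Holding u = All (λ w → Member w u)

-- Quantifying over all tables that contain the list spares a proof that
-- justification is monotone in the table.
Supported : List ℕ → Set
Supported ws = ∀ u → Holding u ws → All (λ w → Justified w u) ws

Derivable : ℕ → Set
Derivable w = ∃ λ ws → w ∈ₗ ws × Supported ws

supported-++ : ∀ {vs ws} → Supported vs → Supported ws → Supported (vs List.++ ws)
supported-++ {vs} vs-supported ws-supported u H =
  ++⁺ (vs-supported u (++⁻ˡ vs H)) (ws-supported u (++⁻ʳ vs H))

derive : ∀ {t p x y} ws → Supported ws → (∀ u → Holding u ws → Rule t p x y u) →
         Derivable (fact (pair t p) x y)
derive {t} {p} {x} {y} ws ws-supported by = fact (pair t p) x y List.∷ ws , here refl , λ where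
  u (_ ∷ H) → subst (λ A → A) (sym (justified-fact t p x y u)) (by u H) ∷ ws-supported u H

derive₀ : ∀ {t p x y} → (∀ u → Rule t p x y u) → Derivable (fact (pair t p) x y)
derive₀ by = derive List.[] (λ _ _ → []) λ u _ → by u

derive₁ : ∀ {t p x y v} → Derivable v → (∀ u → Member v u → Rule t p x y u) →
          Derivable (fact (pair t p) x y)
derive₁ (vs , v∈vs , V) by = derive vs V λ u H → by u (All.lookup H v∈vs)

derive₂ : ∀ {t p x y v w} → Derivable v → Derivable w →
          (∀ u → Member v u → Member w u → Rule t p x y u) → Derivable (fact (pair t p) x y)
derive₂ (vs , v∈vs , V) (ws , w∈ws , W) by = derive (vs List.++ ws) (supported-++ V W) λ u H →
  by u (All.lookup (++⁻ˡ vs H) v∈vs) (All.lookup (++⁻ʳ vs H) w∈ws)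

-- A minimisation has a premise for each argument below its value; their lists of facts are merged
-- by induction on that value.
derive-below : ∀ {P : ℕ → ℕ → ℕ} y → (∀ i → i < y → ∃ λ z → Derivable (P i z)) →
               ∃ λ ws → Supported ws × (∀ u → Holding u ws → ∀ i → i < y → ∃ λ z → Member (P i z) u)
derive-below zero    below = List.[] , (λ _ _ → []) , λ _ _ _ ()
derive-below {P} (suc y) below with derive-below {P} y (λ i i<y → below i (m<n⇒m<1+n i<y)) | below y ≤-refl
... | vs , V , vs-holds | z , ws , w∈ws , W = vs List.++ ws , supported-++ V W , holds
  where
  holds : ∀ u → Holding u (vs List.++ ws) → ∀ i → i < suc y → ∃ λ z → Member (P i z) u
  holds u H i i<1+y with m<1+n⇒m<n∨m≡n i<1+y
  ... | inj₁ i<y  = vs-holds u (++⁻ˡ vs H) i i<y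
  ... | inj₂ refl = z , All.lookup (++⁻ʳ vs H) w∈ws

proj-derivable : ∀ (i : Fin k) xs → Derivable (fact ⌜ projᶜ i ⌝ (inputs xs) (lookup xs i))
proj-derivable zero    (x ∷ xs) = derive₀ λ u → proj-zero-intro u
proj-derivable (suc i) (x ∷ xs) = derive₁ (proj-derivable i xs) λ u → proj-suc-intro u

derivable  : ∀ {e : Code k} {xs y} → e [ xs ]⇓ y → Derivable (fact ⌜ e ⌝ (inputs xs) y)
derivable* : ∀ {gs : Vec (Code k) m} {xs ys} → gs [ xs ]⇓* ys → Derivable (fact ⌜ gs ⌝* (inputs xs) (inputs ys))
derivable-suc : ∀ {e : Code k} {xs} → (∃ λ z → e [ xs ]⇓ suc z) → ∃ λ z → Derivable (fact ⌜ e ⌝ (inputs xs) (suc z))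

derivable zero⇓                = derive₀ λ u → zero-intro u
derivable (suc⇓ {x})           = derive₀ λ u → suc-intro u
derivable {xs = xs} (proj⇓ i)  = proj-derivable i xs
derivable (comp⇓ ds d)         = derive₂ (derivable* ds) (derivable d) λ u → comp-intro u
derivable (precZ⇓ d)           = derive₁ (derivable d) λ u → prec-zero-intro u
derivable (precS⇓ d d′)        = derive₂ (derivable d) (derivable d′) λ u → prec-suc-intro u
derivable {e = muᶜ f} {xs} {y} (mu⇓ below d)
  with derive-below {λ i z → fact ⌜ f ⌝ (inputs (i ∷ xs)) (suc z)} y (λ i i<y → derivable-suc (below i i<y))
     | derivable d
... | vs , V , vs-hold | ws , w∈ws , W = derive (vs List.++ ws) (supported-++ V W) λ u H →
  mu-intro u (vs-hold u (++⁻ˡ vs H)) (All.lookup (++⁻ʳ vs H) w∈ws)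

derivable* []       = derive₀ λ u → nil-intro u
derivable* (d ∷ ds) = derive₂ (derivable d) (derivable* ds) λ u → cons-intro u

derivable-suc (z , d) = z , derivable d

-- Kleene's T predicate, with a closed table in the role of the computation. Bounding the table by
-- the last argument makes the predicate monotone in it. A single input x is coded as `pair x 0`.
haltsWithin : DecPred 3
haltsWithin = ∃<ᵈ var 2F · closed ⟨ var 0F ∷ [] ⟩ᵈ
  ∧ᵈ (∃<ᵈ var 0F · factᵈ (var 2F) (pairᶠ (var 3F) (const 0)) (var 0F) (var 1F))

opaque
  HaltsWithin : (e x s : ℕ) → Set
  HaltsWithin e x s = pred haltsWithin (e ∷ x ∷ s ∷ [])

  halts-mono : ∀ {e x s t} → s ≤ t → HaltsWithin e x s → HaltsWithin e x t
  halts-mono s≤t (u , u<s , rest) = u , <-≤-trans u<s s≤t , rest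

opaque
  unfolding Member HaltsWithin

  halts-sound : ∀ (e : Code 1) {x s} → HaltsWithin ⌜ e ⌝ x s → Dom e x
  halts-sound e {x} (u , _ , closed-u , y , _ , F) = y , Soundness.sound closed-u e (x ∷ []) F

  halts-intro : ∀ {e x y} u → Closed u → Member (fact e (pair x 0) y) u → HaltsWithin e x (suc u)
  halts-intro {e} {x} {y} u closed-u F =
    u , ≤-refl , closed-u , y , Introduction.output< u {e} {pair x 0} {y} F , F

halts-complete : ∀ (e : Code 1) {x} → Dom e x → ∃ λ s → HaltsWithin ⌜ e ⌝ x s
halts-complete e {x} (y , d) = let ws , w∈ws , W = derivable d in
  suc (encode ws) , halts-intro (encode ws)
    (all-justified⇒closed (W (encode ws) (All.tabulate member-encode))) (member-encode w∈ws)

-- Π₂ cohesive subsets of Π₁ sets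

-- The order of the states is the lexicographic order of the first k bits.
state : (ℕ → ℕ → ℕ) → ℕ → ℕ → ℕ
state bit zero    x = 0
state bit (suc k) x = state bit k x + state bit k x + bit k x

-- At level k, x is exempt if its state exceeds those of all z with `k ≤ z < x`; otherwise no later
-- y may have a larger state than x. The exemption leaves infinitely many survivors, the requirement
-- makes them homogeneous.
Survivor : (ℕ → ℕ → ℕ) → Pred ℕ 0ℓ
Survivor bit x = ∀ k z y → k ≤ z → z < x → x < y →
  state bit k x ≤ state bit k z → ¬ state bit k x < state bit k y

Frequently Eventually : Pred ℕ 0ℓ → Set
Frequently P = ∀ N → ∃ λ n → N ≤ n × P n
Eventually P = ∃ λ N → ∀ n → N ≤ n → P n

eventually-below : ∀ {P : ℕ → Pred ℕ 0ℓ} → (∀ i → Eventually (P i)) →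
                   ∀ m → Eventually λ n → ∀ i → i < m → P i n
eventually-below ev zero = 0 , λ _ _ _ ()
eventually-below {P} ev (suc m) = let N , below = eventually-below {P} ev m
                                      M , at-m = ev m in
  N ⊔ M , λ n N⊔M≤n i i<1+m → case N M n N⊔M≤n below at-m (m<1+n⇒m<n∨m≡n i<1+m)
  where
  case : ∀ {i} N M n → N ⊔ M ≤ n → (∀ n → N ≤ n → ∀ i → i < m → P i n) → (∀ n → M ≤ n → P m n) →
         i < m ⊎ i ≡ m → P i n
  case N M n le below at-m (inj₁ i<m)  = below n (≤-trans (m≤m⊔n N M) le) _ i<m
  case N M n le below at-m (inj₂ refl) = at-m n (≤-trans (m≤n⊔m N M) le)

bounded : ∀ {X} → Finite X → ∃ λ N → ∀ {n} → n ∈ X → n < N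
bounded (xs , X⊆xs) = let N , below = go xs in N , λ n∈X → below (X⊆xs n∈X)
  where
  go : ∀ xs → ∃ λ N → ∀ {n} → n ∈ₗ xs → n < N
  go List.[]       = 0 , λ ()
  go (x List.∷ xs) = let N , below = go xs in suc x ⊔ N , λ where
    (here refl)  → m≤m⊔n (suc x) N
    (there n∈xs) → ≤-trans (below n∈xs) (m≤n⊔m (suc x) N)

frequently⇒infinite : ∀ {X} → Frequently X → Infinite X
frequently⇒infinite freq finite = let N , below = bounded finite
                                      n , N≤n , n∈X = freq N in
  <⇒≱ (below n∈X) N≤n

eventually⇒⊆* : ∀ {X Y} → Eventually (λ n → n ∈ X → n ∈ Y) → X ⊆* Y
eventually⇒⊆* (N , X⊆Y) = upTo N , λ (n∈X , n∉Y) → ∈-upTo⁺ (≰⇒> λ N≤n → n∉Y (X⊆Y _ N≤n n∈X))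

module _ (bit : ℕ → ℕ → ℕ) (bit≤1 : ∀ i x → bit i x ≤ 1) where

  private
    σ : ℕ → ℕ → ℕ
    σ = state bit

  state-bounded : ∀ k → ∃ λ M → ∀ x → σ k x ≤ M
  state-bounded zero    = 0 , λ _ → z≤n
  state-bounded (suc k) = let M , σ≤M = state-bounded k in
    M + M + 1 , λ x → +-mono-≤ (+-mono-≤ (σ≤M x) (σ≤M x)) (bit≤1 k x)

  -- A difference in the states doubles to at least 2, and the next bit cannot make up for that.
  state-suc-< : ∀ {k x y} → σ k x < σ k y → σ (suc k) x < σ (suc k) y
  state-suc-< {k} {x} {y} lt = begin-strict
    σ k x + σ k x + bit k x ≤⟨ +-monoʳ-≤ (σ k x + σ k x) (bit≤1 k x) ⟩
    σ k x + σ k x + 1       ≡⟨ +-assoc (σ k x) _ _ ⟩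
    σ k x + (σ k x + 1)     ≡⟨ cong (σ k x +_) (+-comm (σ k x) 1) ⟩
    σ k x + suc (σ k x)     <⟨ +-mono-<-≤ lt lt ⟩
    σ k y + σ k y           ≤⟨ m≤m+n _ _ ⟩
    σ k y + σ k y + bit k y ∎
    where open ≤-Reasoning

  state-mono-< : ∀ {j k x y} → j ≤ k → σ j x < σ j y → σ k x < σ k y
  state-mono-< {j} {k} {x} {y} j≤k lt = go (≤⇒≤′ j≤k)
    where
    go : ∀ {k} → j ≤′ k → σ k x < σ k y
    go ≤′-refl       = lt
    go (≤′-step j≤k) = state-suc-< (go j≤k)

  bits-agree : ∀ {k x y} → σ (suc k) x ≡ σ (suc k) y → bit k x ≡ bit k y
  bits-agree {k} {x} {y} eq = +-cancelˡ-≡ (σ k x + σ k x) (bit k x) (bit k y)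
    (trans eq (cong (λ s → s + s + bit k y) (sym states-agree)))
    where
    states-agree : σ k x ≡ σ k y
    states-agree = ≤-antisym
      (≮⇒≥ λ lt → <⇒≢ (state-suc-< lt) (sym eq))
      (≮⇒≥ λ lt → <⇒≢ (state-suc-< lt) eq)

  module _ (em : ExcludedMiddle 0ℓ) where

    -- The first maximum of σ n on [n, ∞) survives: for k ≤ n a rival y > x
    -- would exceed it, for k > n so would the earlier z ≥ k.
    survivors-frequent : Frequently (Survivor bit)
    survivors-frequent n = x , n≤x , survives
      where
      -- `d` bounds how often the state can still increase, so the climb ends.
      climb : ∀ d x → n ≤ x → proj₁ (state-bounded n) ≤ σ n x + d →
              ∃ λ x → n ≤ x × (∀ y → n ≤ y → σ n y ≤ σ n x)
      climb zero x n≤x M≤ = x , n≤x , λ y _ →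
        ≤-trans (proj₂ (state-bounded n) y) (subst (proj₁ (state-bounded n) ≤_) (+-identityʳ _) M≤)
      climb (suc d) x n≤x M≤ with em {∃ λ y → n ≤ y × σ n x < σ n y}
      ... | yes (y , n≤y , lt) = climb d y n≤y
              (≤-trans M≤ (≤-trans (≤-reflexive (+-suc (σ n x) d)) (+-monoˡ-≤ d lt)))
      ... | no none = x , n≤x , λ y n≤y → ≮⇒≥ λ lt → none (y , n≤y , lt)
      some-max = climb (proj₁ (state-bounded n)) n ≤-refl (m≤n+m _ _)
      first-max = least (λ _ → em) (proj₁ some-max) (proj₂ some-max)
      x = proj₁ first-max
      n≤x = proj₁ (proj₁ (proj₂ first-max))
      maximal = proj₂ (proj₁ (proj₂ first-max))
      earlier : ∀ {z} → n ≤ z → z < x → σ n z < σ n x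
      earlier {z} n≤z z<x = ≰⇒> λ σx≤σz →
        proj₂ (proj₂ first-max) z z<x (n≤z , λ y n≤y → ≤-trans (maximal y n≤y) σx≤σz)
      survives : Survivor bit x
      survives k z y k≤z z<x x<y σx≤σz σx<σy with ≤-total k n
      ... | inj₁ k≤n = <⇒≱ (state-mono-< k≤n σx<σy) (maximal y (≤-trans n≤x (<⇒≤ x<y)))
      ... | inj₂ n≤k = <⇒≱ (state-mono-< n≤k (earlier (≤-trans n≤k k≤z) z<x)) σx≤σz

    -- Lower the bound as long as it still holds eventually; a bound that cannot be lowered is
    -- attained infinitely often.
    limsup : ∀ (f : ℕ → ℕ) M → Eventually (λ n → f n ≤ M) →
             ∃ λ m → Frequently (λ n → f n ≡ m) × Eventually (λ n → f n ≤ m)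
    limsup f zero (N₀ , f≤0) = 0 , (λ N → N ⊔ N₀ , m≤m⊔n N N₀ , n≤0⇒n≡0 (f≤0 _ (m≤n⊔m N N₀))) , N₀ , f≤0
    limsup f (suc M) (N₀ , f≤1+M) with em {Eventually λ n → f n ≤ M}
    ... | yes ev = limsup f M ev
    ... | no ¬ev = suc M , frequent , N₀ , f≤1+M
      where
      frequent : Frequently λ n → f n ≡ suc M
      frequent N with em {∃ λ n → N ≤ n × f n ≡ suc M}
      ... | yes found = found
      ... | no none = contradiction
              (N ⊔ N₀ , λ n N⊔N₀≤n → s≤s⁻¹ (≤∧≢⇒< (f≤1+M n (≤-trans (m≤n⊔m N N₀) N⊔N₀≤n))
                                        λ eq → none (n , ≤-trans (m≤m⊔n N N₀) N⊔N₀≤n , eq)))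
              ¬ev

    -- Fix a late `z ≥ k` with state m. From then on states are at most m, so z denies the exemption
    -- to every later x; as m recurs at some y beyond x, a survivor x cannot have a smaller state.
    survivors-homogeneous : ∀ k → ∃ λ m → Frequently (λ x → σ k x ≡ m) × Eventually (λ x → σ k x ≤ m) ×
                                          Eventually (λ x → x ∈ Survivor bit → σ k x ≡ m)
    survivors-homogeneous k =
      let M , σ≤M = state-bounded k
          m , frequent , N , σ≤m = limsup (σ k) M (0 , λ x _ → σ≤M x)
          z , k⊔N≤z , σz≡m = frequent (k ⊔ N)
      in m , frequent , (N , σ≤m) , suc z , λ x z<x survives →
         let y , x<y , σy≡m = frequent (suc x)
             σx≤m = σ≤m x (≤-trans (≤-trans (m≤n⊔m k N) k⊔N≤z) (<⇒≤ z<x))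
         in ≤-antisym σx≤m (≮⇒≥ λ σx<m →
              survives k z y (≤-trans (m≤m⊔n k N) k⊔N≤z) z<x x<y
                (subst (σ k x ≤_) (sym σz≡m) σx≤m) (subst (σ k x <_) (sym σy≡m) σx<m))

    survivors-decide : ∀ i → Eventually (λ x → x ∈ Survivor bit → bit i x ≡ 1) ⊎
                             Eventually (λ x → x ∈ Survivor bit → bit i x ≡ 0)
    survivors-decide i =
      let m , _ , _ , N , σ≡m = survivors-homogeneous (suc i)
          -- One late survivor serves as a sample: all others share its state at level `suc i`, and
          -- with it the last digit, bit i.
          c , N≤c , c-survives = survivors-frequent N
          agree : ∀ x → N ≤ x → x ∈ Survivor bit → bit i x ≡ bit i c
          agree x N≤x x-survives = bits-agree {i} (trans (σ≡m x N≤x x-survives) (sym (σ≡m c N≤c c-survives)))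
      in case (bit i c) (bit≤1 i c) (N , agree)
      where
      case : ∀ b → b ≤ 1 → Eventually (λ x → x ∈ Survivor bit → bit i x ≡ b) →
             Eventually (λ x → x ∈ Survivor bit → bit i x ≡ 1) ⊎ Eventually (λ x → x ∈ Survivor bit → bit i x ≡ 0)
      case zero       _ ev = inj₂ ev
      case (suc zero) _ ev = inj₁ ev
      case (suc (suc _)) (s≤s ()) _

    -- The bit 0 is the leading one, so a value 1 that recurs is preferred.
    survivors-prefer-bit₀ : Frequently (λ x → bit 0 x ≡ 1) → Eventually (λ x → x ∈ Survivor bit → bit 0 x ≡ 1)
    survivors-prefer-bit₀ frequent =
      let m , _ , (N , σ≤m) , M , σ≡m = survivors-homogeneous 1
          z , N≤z , bit≡1 = frequent N
          1≤m = subst (_≤ m) bit≡1 (σ≤m z N≤z)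
      in M , λ x M≤x survives → ≤-antisym (bit≤1 0 x) (subst (1 ≤_) (sym (σ≡m x M≤x survives)) 1≤m)

state-cong : ∀ {b c : ℕ → ℕ → ℕ} k x → (∀ i → i < k → b i x ≡ c i x) → state b k x ≡ state c k x
state-cong zero    x eq = refl
state-cong (suc k) x eq = cong₂ (λ s b → s + s + b)
  (state-cong k x λ i i<k → eq i (m<n⇒m<1+n i<k)) (eq k ≤-refl)

-- The survivors of limit computable bits form a Π₂ set

module _ (B : DecPred 3) where

  opaque
    stage : ℕ → ℕ → ℕ → ℕ
    stage s i x = apply (character B) (i ∷ x ∷ s ∷ [])

    stage-yes : ∀ {i x s} → pred B (i ∷ x ∷ s ∷ []) → stage s i x ≡ 1
    stage-yes = character-yes B

    stage-no : ∀ {i x s} → ¬ pred B (i ∷ x ∷ s ∷ []) → stage s i x ≡ 0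
    stage-no = character-no B

    stage-computes : ∀ (xs : Vec ℕ 3) → apply (character B) xs ≡ stage (lookup xs 2F) (lookup xs 0F) (lookup xs 1F)
    stage-computes (i ∷ x ∷ s ∷ []) = refl

  stageᶠ : Fn 3
  stageᶠ = recast (character B) {λ xs → stage (lookup xs 2F) (lookup xs 0F) (lookup xs 1F)} stage-computes

  stateᶠ : Fn 3
  stateᶠ = recast (primrec (const 0) (var 1F +ᶠ var 1F +ᶠ stageᶠ ⟨ var 0F ∷ var 2F ∷ var 3F ∷ [] ⟩ᶠ))
                  {λ xs → state (stage (lookup xs 2F)) (lookup xs 0F) (lookup xs 1F)} correct
    where
    correct : ∀ xs → _
    correct (zero  ∷ x ∷ s ∷ []) = refl
    correct (suc k ∷ x ∷ s ∷ []) = cong (λ r → r + r + stage s k x) (correct (k ∷ x ∷ s ∷ []))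

  -- No rival `y ≤ a` is visible at stage s. The clause `a ≤ s` forces the stage to grow with a, so
  -- that an existential witness cannot be a stage where the bits are still wrong. Under all binders
  -- the variables are k, z, y, x, a, s.
  survivesAt : DecPred 3
  survivesAt = var 1F ≤ᵈ var 2F ∧ᵈ (∀<ᵈ sucᶠ (var 1F) · var 1F <ᵈ var 0F ⇒ᵈ
    ∀<ᵈ var 1F · ∀<ᵈ sucᶠ (var 0F) · ¬ᵈ
      (stateᶠ ⟨ var 0F ∷ var 3F ∷ var 5F ∷ [] ⟩ᶠ ≤ᵈ stateᶠ ⟨ var 0F ∷ var 1F ∷ var 5F ∷ [] ⟩ᶠ ∧ᵈ
       stateᶠ ⟨ var 0F ∷ var 3F ∷ var 5F ∷ [] ⟩ᶠ <ᵈ stateᶠ ⟨ var 0F ∷ var 2F ∷ var 5F ∷ [] ⟩ᶠ))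

  module _ (bit : ℕ → ℕ → ℕ) (converges : ∀ i x → Eventually λ s → stage s i x ≡ bit i x) where

    states-converge : ∀ a → Eventually λ s → ∀ x → x < a → ∀ k → k < a → state (stage s) k x ≡ state bit k x
    states-converge a =
      let N , eq = eventually-below {λ x s → ∀ i → i < a → stage s i x ≡ bit i x}
                     (λ x → eventually-below {λ i s → stage s i x ≡ bit i x} (λ i → converges i x) a) a
      in N , λ s N≤s x x<a k k<a → state-cong k x λ i i<k → eq s N≤s x x<a i (<-trans i<k k<a)

    survivors-Π₂ : IsΠ₂ (Survivor bit)
    survivors-Π₂ = (λ x a s → pred survivesAt (x ∷ a ∷ s ∷ []))
                 , (DecPred.code survivesAt , λ x a s → decides survivesAt (x ∷ a ∷ s ∷ []))
                 , λ x → mk⇔ (to x) (from x)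
      where
      to : ∀ x → x ∈ Survivor bit → ∀ a → ∃ λ s → pred survivesAt (x ∷ a ∷ s ∷ [])
      to x survives a =
        let N , eq = states-converge (suc a)
            s = N ⊔ a
            eq′ = eq s (m≤m⊔n N a)
        in s , m≤n⊔m N a , λ y y≤a x<y z z<x k k≤z (le , lt) →
           let x≤a = <-trans x<y y≤a
               z≤a = <-trans z<x x≤a
               k≤a = ≤-<-trans (s≤s⁻¹ k≤z) z≤a
           in survives k z y (s≤s⁻¹ k≤z) z<x x<y
                (subst₂ _≤_ (eq′ x x≤a k k≤a) (eq′ z z≤a k k≤a) le)
                (subst₂ _<_ (eq′ x x≤a k k≤a) (eq′ y y≤a k k≤a) lt)
      from : ∀ x → (∀ a → ∃ λ s → pred survivesAt (x ∷ a ∷ s ∷ [])) → x ∈ Survivor bit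
      from x approx k z y k≤z z<x x<y le lt =
        let N , eq = states-converge (suc y)
            -- The bound brings y into range and puts the stage past the convergence of all states
            -- up to y.
            s , a≤s , none = approx (N ⊔ y)
            eq′ = eq s (≤-trans (m≤m⊔n N y) a≤s)
            x≤y = <-trans x<y ≤-refl
            z≤y = <-trans z<x x≤y
            k≤y = ≤-<-trans k≤z z≤y
        in none y (s≤s (m≤n⊔m N y)) x<y z z<x k (s≤s k≤z)
             ( subst₂ _≤_ (sym (eq′ x x≤y k k≤y)) (sym (eq′ z z≤y k k≤y)) le
             , subst₂ _<_ (sym (eq′ x x≤y k k≤y)) (sym (eq′ y ≤-refl k k≤y)) lt)

-- The cohesive set attached to a Π₁ set

module _ (em : ExcludedMiddle 0ℓ) where

  indicator : Set → ℕ
  indicator P with em {P}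
  ... | yes _ = 1
  ... | no  _ = 0

  indicator≤1 : ∀ P → indicator P ≤ 1
  indicator≤1 P with em {P}
  ... | yes _ = ≤-refl
  ... | no  _ = z≤n

  indicator-yes : ∀ {P} → P → indicator P ≡ 1
  indicator-yes {P} p with em {P}
  ... | yes _ = refl
  ... | no ¬p = contradiction p ¬p

  indicator-no : ∀ {P} → ¬ P → indicator P ≡ 0
  indicator-no {P} ¬p with em {P}
  ... | yes p = contradiction p ¬p
  ... | no _  = refl

  indicator≡1 : ∀ {P} → indicator P ≡ 1 → P
  indicator≡1 {P} eq with em {P}
  ... | yes p = p

  indicator≡0 : ∀ {P} → indicator P ≡ 0 → ¬ P
  indicator≡0 {P} eq with em {P}
  ... | no ¬p = ¬p

  ¬∀⇒∃¬ : ∀ {P : ℕ → Set} → ¬ (∀ n → P n) → ∃ λ n → ¬ P n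
  ¬∀⇒∃¬ {P} ¬all with em {∃ λ n → ¬ P n}
  ... | yes found = found
  ... | no none = contradiction (λ n → decidable-stable em λ ¬Pn → none (n , ¬Pn)) ¬all

  -- Q (c , x) says that x has not left the Π₁ set at stage c.
  module Π₁Set (Q : DecPred 2) where

    Π₁ : Pred ℕ 0ℓ
    Π₁ x = ∀ c → pred Q (c ∷ x ∷ [])

    -- As the stage grows, index 0 can only turn from true to false and the other indices only from
    -- false to true. Each answer changes at most once, so it has a limit.
    test : DecPred 3
    test = caseᵈ (∀<ᵈ var 1F · Q ⟨ var 0F ∷ var 1F ∷ [] ⟩ᵈ) haltsWithin

    Limit : ℕ → Pred ℕ 0ℓ
    Limit zero    x = Π₁ x
    Limit (suc e) x = ∃ λ s → HaltsWithin e x s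

    bit : ℕ → ℕ → ℕ
    bit i x = indicator (Limit i x)

    Settles : ℕ → ℕ → Set
    Settles i x = Eventually λ s → stage test s i x ≡ bit i x

    settles-yes : ∀ {i x} → Limit i x → Eventually (λ s → pred test (i ∷ x ∷ s ∷ [])) → Settles i x
    settles-yes {i} {x} l (N , holds) = N , λ s N≤s →
      trans (stage-yes test (holds s N≤s)) (sym (indicator-yes l))

    settles-no : ∀ {i x} → ¬ Limit i x → Eventually (λ s → ¬ pred test (i ∷ x ∷ s ∷ [])) → Settles i x
    settles-no {i} {x} ¬l (N , fails) = N , λ s N≤s →
      trans (stage-no test (fails s N≤s)) (sym (indicator-no ¬l))

    settles : ∀ i x → Settles i x
    settles zero x = case em
      where
      case : Dec (Π₁ x) → Settles 0 x
      case (yes p) = settles-yes p (0 , λ s _ c c<s → p c)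
      case (no ¬p) = let c , ¬Qc = ¬∀⇒∃¬ ¬p in
        settles-no ¬p (suc c , λ s c<s all → ¬Qc (all c c<s))
    settles (suc e) x = case em
      where
      opaque
        unfolding HaltsWithin
        case : Dec (Limit (suc e) x) → Settles (suc e) x
        case (yes (N , h)) = settles-yes (N , h) (N , λ s N≤s → halts-mono N≤s h)
        case (no ¬h)       = settles-no ¬h (0 , λ s _ h → ¬h (s , h))

    C : Pred ℕ 0ℓ
    C = Survivor bit

    bit≤1 : ∀ i x → bit i x ≤ 1
    bit≤1 i x = indicator≤1 (Limit i x)

    C-Π₂ : IsΠ₂ C
    C-Π₂ = survivors-Π₂ test bit settles

    C-infinite : Infinite C
    C-infinite = frequently⇒infinite (survivors-frequent bit bit≤1 em)

    C-cohesive : IsCohesive C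
    C-cohesive = C-infinite , λ W (e , W⇔dom) →
      [ (λ (N , one)  → inj₁ (eventually⇒⊆* (N , λ x N≤x x∈C →
          Equivalence.from (W⇔dom x) (halts-sound e (proj₂ (indicator≡1 (one x N≤x x∈C)))))))
      , (λ (N , nil) → inj₂ (eventually⇒⊆* (N , λ x N≤x x∈C x∈W →
          indicator≡0 (nil x N≤x x∈C) (halts-complete e (Equivalence.to (W⇔dom x) x∈W)))))
      ]′ (survivors-decide bit bit≤1 em (suc ⌜ e ⌝))

    C-eventually⊆Π₁ : Frequently Π₁ → Eventually λ x → x ∈ C → x ∈ Π₁
    C-eventually⊆Π₁ frequent =
      let N , one = survivors-prefer-bit₀ bit bit≤1 em λ N →
            let n , N≤n , p = frequent N in n , N≤n , indicator-yes p
      in N , λ x N≤x x∈C → indicator≡1 (one x N≤x x∈C)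

-- The cohesive power of a copy of ω

⊆*⇒eventually : ExcludedMiddle 0ℓ → ∀ {X Y} → X ⊆* Y → Eventually (λ n → n ∈ X → n ∈ Y)
⊆*⇒eventually em X⊆*Y = let N , below = bounded X⊆*Y in
  N , λ n N≤n n∈X → decidable-stable em λ n∉Y → <⇒≱ (below (n∈X , n∉Y)) N≤n

infix 4 _⊏_

_⊏_ : ℕ ⊎ ℚ → ℕ ⊎ ℚ → Set
_⊏_ = _⊎-<_ ℕ._<_ ℚ._<_

⊏-inj₁ : ∀ {v n} → v ⊏ inj₁ n → ∃ λ m → v ≡ inj₁ m × m < n
⊏-inj₁ (₁∼₁ m<n) = _ , refl , m<n

-- All the `v i` are natural numbers, and the ascent forces the i-th to be at least i; at `i = n`
-- this contradicts the bound.
no-ascent-below-inj₁ : ∀ (v : ℕ → ℕ ⊎ ℚ) → (∀ i → v i ⊏ v (suc i)) → ∀ {n} → ¬ (∀ i → v i ⊏ inj₁ n)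
no-ascent-below-inj₁ v ascent {n} below =
  let m , v≡m , n≤m = high n
      m′ , v≡m′ , m′<n = ⊏-inj₁ (below n)
  in <⇒≱ m′<n (subst (n ≤_) (inj₁-injective (trans (sym v≡m) v≡m′)) n≤m)
  where
  high : ∀ i → ∃ λ m → v i ≡ inj₁ m × i ≤ m
  high zero = let m , eq , _ = ⊏-inj₁ (below 0) in m , eq , z≤n
  high (suc i) =
    let m , eq , i≤m = high i
        m′ , eq′ , _ = ⊏-inj₁ (below (suc i))
        m″ , eq″ , m″<m′ = ⊏-inj₁ (subst (v i ⊏_) eq′ (ascent i))
    in m′ , eq′ , ≤-<-trans (subst (i ≤_) (inj₁-injective (trans (sym eq) eq″)) i≤m) m″<m′

inj₂⊏̸inj₁ : ∀ {p n} → ¬ inj₂ p ⊏ inj₁ n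
inj₂⊏̸inj₁ ()

⊏-dense : ∀ {p q} → inj₂ p ⊏ inj₂ q → ∃ λ r → inj₂ p ⊏ inj₂ r × inj₂ r ⊏ inj₂ q
⊏-dense (₂∼₂ p<q) = let r , p<r , r<q = ℚ.<-dense p<q in r , ₂∼₂ p<r , ₂∼₂ r<q

≈-inj₂ : ∀ {v : ℕ ⊎ ℚ} {q} → ⊎.Pointwise _≡_ _≡_ v (inj₂ q) → v ≡ inj₂ q
≈-inj₂ (inj₂ refl) = refl

-- Neighbours in the copy and in its cohesive power

module Copy (em : ExcludedMiddle 0ℓ) (𝓛 : ComputableLinearOrder) (copy : IsCopyOfω 𝓛) where
  open ComputableLinearOrder 𝓛

  rank : Σ ℕ L → ℕ
  rank = proj₁ copy

  open IsOrderIsomorphism (proj₂ copy) using (surjective; injective; mono; cancel)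
    renaming (cong to rank-cong)

  element : ℕ → Σ ℕ L
  element i = proj₁ (surjective i)

  rank-element : ∀ i → rank (element i) ≡ i
  rank-element i = proj₂ (surjective i) refl

  nth : ℕ → ℕ
  nth i = proj₁ (element i)

  nth∈L : ∀ i → nth i ∈ L
  nth∈L i = proj₂ (element i)

  nth-injective : ∀ {i j} → nth i ≡ nth j → i ≡ j
  nth-injective {i} {j} eq = trans (sym (rank-element i))
    (trans (rank-cong {element i} {element j} eq) (rank-element j))

  nth-mono : ∀ {i j} → i < j → nth i ≺ nth j
  nth-mono {i} {j} i<j = cancel (subst₂ _<_ (sym (rank-element i)) (sym (rank-element j)) i<j)

  nth-cancel : ∀ {i j} → nth i ≺ nth j → i < j
  nth-cancel {i} {j} lt = subst₂ _<_ (rank-element i) (rank-element j) (mono {element i} {element j} lt)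

  nth-surjective : ∀ {a} → a ∈ L → ∃ λ i → a ≡ nth i
  nth-surjective {a} a∈L = rank (a , a∈L) , injective {a , a∈L} {element _} (sym (rank-element _))

  nth-unbounded : ∀ N → ∃ λ i → N ≤ nth i
  nth-unbounded N = decidable-stable em λ none →
    let below = λ i → ≰⇒> λ N≤ → none (i , N≤)
        i , j , i<j , eq = pigeonhole (n<1+n N) λ i → fromℕ< (below (toℕ i))
    in <⇒≢ i<j (nth-injective (fromℕ<-injective _ _ (below (toℕ i)) (below (toℕ j)) eq))

  precedes : DecPred 2
  precedes = record
    { pred    = λ xs → lookup xs 0F ≺ lookup xs 1F
    ; code    = proj₁ ≺-computable
    ; decides = λ { (a ∷ b ∷ []) → proj₂ ≺-computable a b }
    }

  -- `var 0F` is the candidate c for an element in between and `var 1F` the coded pair. Quantifying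
  -- over c gives adjacency its Π₁ form.
  notBetween : DecPred 2
  notBetween = var 1F ≡ᵈ pairᶠ (fstᶠ (var 1F)) (sndᶠ (var 1F))
            ∧ᵈ precedes ⟨ fstᶠ (var 1F) ∷ sndᶠ (var 1F) ∷ [] ⟩ᵈ
            ∧ᵈ ¬ᵈ (precedes ⟨ fstᶠ (var 1F) ∷ var 0F ∷ [] ⟩ᵈ ∧ᵈ precedes ⟨ var 0F ∷ sndᶠ (var 1F) ∷ [] ⟩ᵈ)

  record IsSuccessorPair (x : ℕ) : Set where
    field
      is-pair  : x ≡ pair (fst x) (snd x)
      precede  : fst x ≺ snd x
      adjacent : ∀ c → ¬ (fst x ≺ c × c ≺ snd x)

  open Π₁Set em notBetween public

  open IsSuccessorPair

  Π₁⇒successorPair : ∀ {x} → x ∈ Π₁ → IsSuccessorPair x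
  Π₁⇒successorPair p = record
    { is-pair  = proj₁ (p 0)
    ; precede  = proj₁ (proj₂ (p 0))
    ; adjacent = λ c → proj₂ (proj₂ (p c))
    }

  successors∈Π₁ : ∀ i → pair (nth i) (nth (suc i)) ∈ Π₁
  successors∈Π₁ i c = sym (cong₂ pair fst≡ snd≡)
    , subst₂ _≺_ (sym fst≡) (sym snd≡) (nth-mono (n<1+n i))
    , λ (a≺c , c≺b) →
        let j , c≡nth = nth-surjective (proj₂ (≺-on-L a≺c))
            i<j = nth-cancel (subst₂ _≺_ fst≡ c≡nth a≺c)
            j<1+i = nth-cancel (subst₂ _≺_ c≡nth snd≡ c≺b)
        in <⇒≱ i<j (s≤s⁻¹ j<1+i)
    where
    fst≡ : fst (pair (nth i) (nth (suc i))) ≡ nth i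
    fst≡ = fst-pair _ _
    snd≡ : snd (pair (nth i) (nth (suc i))) ≡ nth (suc i)
    snd≡ = snd-pair _ _

  -- The first component determines the second, so each j accounts for a single number x; this is
  -- what makes the first components unbounded along C.
  successorPair⇒successors : ∀ {x} → IsSuccessorPair x →
                             ∃ λ j → fst x ≡ nth j × x ≡ pair (nth j) (nth (suc j))
  successorPair⇒successors {x} S =
    let j , a≡ = nth-surjective (proj₁ (≺-on-L (precede S)))
        l , b≡ = nth-surjective (proj₂ (≺-on-L (precede S)))
        j<l = nth-cancel (subst₂ _≺_ a≡ b≡ (precede S))
        l≤1+j = ≮⇒≥ λ 1+j<l → adjacent S (nth (suc j))
          ( subst (_≺ nth (suc j)) (sym a≡) (nth-mono (n<1+n j))
          , subst (nth (suc j) ≺_) (sym b≡) (nth-mono 1+j<l))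
    in j , a≡ , trans (is-pair S) (cong₂ pair a≡ (trans b≡ (cong nth (≤-antisym l≤1+j j<l))))

  Π₁-frequent : Frequently Π₁
  Π₁-frequent N = let i , N≤nth = nth-unbounded N in
    _ , ≤-trans N≤nth (m≤pair (nth i) (nth (suc i))) , successors∈Π₁ i

  C-frequent : Frequently C
  C-frequent = survivors-frequent bit bit≤1 em

  C-eventually-successors : Eventually λ x → x ∈ C → IsSuccessorPair x
  C-eventually-successors = let N , p = C-eventually⊆Π₁ Π₁-frequent in
    N , λ x N≤x x∈C → Π₁⇒successorPair (p x N≤x x∈C)

  open CohesivePower C 𝓛

  -- The decidable guard keeps all values in `L`, as `D` demands everywhere and not just on C; where
  -- it fails the search diverges. Adjacency is left to C, almost all of whose elements have it.
  guarded : Fn 2 → DecPred 2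
  guarded t = var 0F ≡ᵈ t ∧ᵈ precedes ⟨ fstᶠ (var 1F) ∷ sndᶠ (var 1F) ∷ [] ⟩ᵈ

  lower upper : DecPred 2
  lower = guarded (fstᶠ (var 1F))
  upper = guarded (sndᶠ (var 1F))

  lower⇓ : ∀ {x} → IsSuccessorPair x → search lower [ x ∷ [] ]⇓ fst x
  lower⇓ S = search-finds lower (refl , precede S) λ i i<a (i≡a , _) → <⇒≢ i<a i≡a

  upper⇓ : ∀ {x} → IsSuccessorPair x → search upper [ x ∷ [] ]⇓ snd x
  upper⇓ S = search-finds upper (refl , precede S) λ i i<b (i≡b , _) → <⇒≢ i<b i≡b

  on-successors : ∀ {Y} → (∀ {x} → IsSuccessorPair x → x ∈ Y) → C ⊆* Y
  on-successors S⊆Y = let N , p = C-eventually-successors in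
    eventually⇒⊆* {C} (N , λ x N≤x x∈C → S⊆Y (p x N≤x x∈C))

  φ ψ : D
  φ = record
    { code    = search lower
    ; range⊆L = λ d → let a≡ , lt = search-sound lower d in subst L (sym a≡) (proj₁ (≺-on-L lt))
    ; C⊆*dom  = on-successors λ S → _ , lower⇓ S
    }
  ψ = record
    { code    = search upper
    ; range⊆L = λ d → let b≡ , lt = search-sound upper d in subst L (sym b≡) (proj₂ (≺-on-L lt))
    ; C⊆*dom  = on-successors λ S → _ , upper⇓ S
    }

  constant⇓ : ∀ i {x} → Fn.code (const (nth i)) [ x ∷ [] ]⇓ nth i
  constant⇓ i {x} = subst (Fn.code (const (nth i)) [ x ∷ [] ]⇓_) (const-apply (nth i))
                      (computes (const (nth i)) (x ∷ []))
    where
    const-apply : ∀ n → apply (const n) (x ∷ []) ≡ n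
    const-apply zero    = refl
    const-apply (suc n) = cong suc (const-apply n)

  constant : ℕ → D
  constant i = record
    { code    = Fn.code (const (nth i))
    ; range⊆L = λ d → subst L (⇓-functional (constant⇓ i) d) (nth∈L i)
    ; C⊆*dom  = on-successors λ _ → nth i , constant⇓ i
    }

  constant-ascent : ∀ i → constant i ≺C constant (suc i)
  constant-ascent i = on-successors λ _ →
    nth i , nth (suc i) , constant⇓ i , constant⇓ (suc i) , nth-mono (n<1+n i)

  -- Only finitely many numbers code a pair of neighbours that begins with one of `nth 0`, ...,
  -- `nth i`. Beyond them, the first component of a pair in C lies above `nth i`.
  constant≺φ : ∀ i → constant i ≺C φ
  constant≺φ i =
    let N , successors = C-eventually-successors
        M , avoids = eventually-below {λ j x → x ≢ pair (nth j) (nth (suc j))}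
                       (λ j → suc (pair (nth j) (nth (suc j))) , λ x lt eq → <⇒≢ lt (sym eq)) (suc i)
    in eventually⇒⊆* {C} (N ⊔ M , λ x N⊔M≤x x∈C →
      let S = successors x (≤-trans (m≤m⊔n N M) N⊔M≤x) x∈C
          j , a≡ , x≡ = successorPair⇒successors S
          i<j = ≰⇒> λ j≤i → avoids x (≤-trans (m≤n⊔m N M) N⊔M≤x) j (s≤s j≤i) x≡
      in nth i , fst x , constant⇓ i , lower⇓ S , subst (nth i ≺_) (sym a≡) (nth-mono i<j))

  =C-refl : ∀ χ → χ =C χ
  =C-refl χ = let xs , p = C⊆*dom χ in
    xs , λ (x∈C , ≢) → p (x∈C , λ (y , d) → ≢ (y , d , d))

  φ≺ψ : φ ≺C ψ
  φ≺ψ = on-successors λ {x} S → fst x , snd x , lower⇓ S , upper⇓ S , precede S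

  -- As C is infinite, some x in C lies beyond all three thresholds; the value of χ at this x would
  -- separate two neighbours of 𝓛.
  φ-ψ-adjacent : ∀ χ → φ ≺C χ → ¬ χ ≺C ψ
  φ-ψ-adjacent χ φ≺χ χ≺ψ =
    let N₀ , successors = C-eventually-successors
        N₁ , left  = ⊆*⇒eventually em {C} φ≺χ
        N₂ , right = ⊆*⇒eventually em {C} χ≺ψ
        x , N≤x , x∈C = C-frequent (N₀ ⊔ (N₁ ⊔ N₂))
        S = successors x (≤-trans (m≤m⊔n N₀ (N₁ ⊔ N₂)) N≤x) x∈C
        N₁⊔N₂≤x = ≤-trans (m≤n⊔m N₀ (N₁ ⊔ N₂)) N≤x
        a , c , φ⇓a , χ⇓c , a≺c = left x (≤-trans (m≤m⊔n N₁ N₂) N₁⊔N₂≤x) x∈C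
        c′ , b , χ⇓c′ , ψ⇓b , c′≺b = right x (≤-trans (m≤n⊔m N₁ N₂) N₁⊔N₂≤x) x∈C
    in adjacent S c
         ( subst (_≺ c) (⇓-functional φ⇓a (lower⇓ S)) a≺c
         , subst₂ _≺_ (⇓-functional χ⇓c′ χ⇓c) (⇓-functional ψ⇓b (upper⇓ S)) c′≺b)

  -- Being above an infinite ascent puts the image of φ into the dense part, and that of ψ with it.
  -- Density yields a point between the two, whose preimage would separate φ from ψ.
  ∏≇ω⊕η : ¬ (∏ C 𝓛 ≅ ⟦ ω ⊕ η ⟧)
  ∏≇ω⊕η (F , iso) = cases (F φ) (F ψ) refl refl
    where
    module F = IsOrderIsomorphism iso
    cases : ∀ v w → F φ ≡ v → F ψ ≡ w → ⊥
    cases (inj₁ n) _ Fφ≡ _ = no-ascent-below-inj₁ (λ i → F (constant i))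
      (λ i → F.mono (constant-ascent i))
      (λ i → subst (F (constant i) ⊏_) Fφ≡ (F.mono (constant≺φ i)))
    cases (inj₂ p) (inj₁ n) Fφ≡ Fψ≡ = inj₂⊏̸inj₁ (subst₂ _⊏_ Fφ≡ Fψ≡ (F.mono φ≺ψ))
    cases (inj₂ p) (inj₂ q) Fφ≡ Fψ≡ =
      let r , p⊏r , r⊏q = ⊏-dense (subst₂ _⊏_ Fφ≡ Fψ≡ (F.mono φ≺ψ))
          χ , χ-maps = F.surjective (inj₂ r)
          Fχ≡ = ≈-inj₂ (χ-maps {χ} (=C-refl χ))
      in φ-ψ-adjacent χ (F.cancel (subst₂ _⊏_ (sym Fφ≡) (sym Fχ≡) p⊏r))
                        (F.cancel (subst₂ _⊏_ (sym Fχ≡) (sym Fψ≡) r⊏q))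

proposition4p3 : ExcludedMiddle 0ℓ →
    (𝓛 : ComputableLinearOrder) → IsCopyOfω 𝓛 →
    Σ (Pred ℕ 0ℓ) λ C → IsΠ₂ C × IsCohesive C × ¬ (∏ C 𝓛 ≅ ⟦ ω ⊕ η ⟧)
proposition4p3 em 𝓛 copy = C , C-Π₂ , C-cohesive , ∏≇ω⊕η
  where open Copy em 𝓛 copy
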